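{- Let $n$ be a positive integer with prime factorization \[ n=2^{a}3^{b}\prod_{i=1}^{r}p_i^{v_i}\prod_{j=1}^{s}q_j^{w_j}, \] where each $p_i\equiv 1\pmod 4$ and each $q_j$ satisfies $3<q_j\equiv 3\pmod 4$. Define $\Lambda(n)=\prod_{i=1}^{r}(1+v_i)\prod_{j=1}^{s}\frac{1+(-1)^{w_j}}{2}$, and let $t$ be the number of prime factors of $n$, counted with multiplicity, that are congruent to $5\pmod{12}$. Then \[ (1,0,9;n)=\begin{cases}(1+(-1)^{a+t})\Lambda(n), & b=0,\\ 0, & b \text{ odd},\\ 4\Lambda(n), & b>0,\ b \text{ even},\end{cases} \qquad (2,2,5;n)=\begin{cases}(1-(-1)^{a+t})\Lambda(n), & b=0,\\ 0, & b \text{ odd},\\ 4\Lambda(n), & b>0,\ b \text{ even}.\end{cases} \]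
   Context: For a binary quadratic form $(a,b,c)$, i.e. $ax^2+bxy+cy^2$, the quantity $(a,b,c;n)$ denotes the number of pairs $(x,y)\in\mathbb{Z}^2$ with $ax^2+bxy+cy^2=n$. -}

module Defs where

open import Data.Nat as ℕ using (ℕ; _%_; _≤_)
open import Data.Nat.Primality using (Prime)
open import Data.Integer as ℤ using (ℤ; +_; -_)
open import Data.Integer.DivMod as ℤD using ()
open import Data.Product using (_×_; _,_; proj₁; proj₂; ∃)
open import Data.List using (List; []; _∷_; map; length; foldr; filter)
open import Data.List.Relation.Unary.All using (All)
open import Data.List.Relation.Unary.Unique.Propositional using (Unique)
open import Data.List.Membership.Propositional using (_∈_)
open import Relation.Binary.PropositionalEquality using (_≡_; _≢_)
open import Relation.Nullary.Decidable using (does)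
open import Data.Nat using (_≟_)
open import Function.Bundles using (_⇔_)

form : ℤ → ℤ → ℤ → ℤ × ℤ → ℤ
form a b c (x , y) = a ℤ.* x ℤ.* x ℤ.+ b ℤ.* x ℤ.* y ℤ.+ c ℤ.* y ℤ.* y

-- (a,b,c;n) = m : the set {(x,y) ∈ ℤ² | a x² + b x y + c y² = n} is finite
-- with exactly m elements (witnessed by a duplicate-free list enumerating it).
RepNumber : ℤ → ℤ → ℤ → ℕ → ℤ → Set
RepNumber a b c n m =
  ∃ λ (L : List (ℤ × ℤ)) →
    Unique L × (∀ p → (p ∈ L) ⇔ (form a b c p ≡ + n)) × (+ length L ≡ m)

sgn : ℕ → ℤ
sgn k = (- ℤ.1ℤ) ℤ.^ k

prodℤ : List ℤ → ℤ
prodℤ = foldr ℤ._*_ ℤ.1ℤ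

prodℕ : List ℕ → ℕ
prodℕ = foldr ℕ._*_ 1

sumℕ : List ℕ → ℕ
sumℕ = foldr ℕ._+_ 0

primePow : ℕ × ℕ → ℕ
primePow (p , v) = p ℕ.^ v

Λ : List (ℕ × ℕ) → List (ℕ × ℕ) → ℤ
Λ ps qs =
  prodℤ (map (λ pv → ℤ.1ℤ ℤ.+ + proj₂ pv) ps) ℤ.*
  prodℤ (map (λ qw → (ℤ.1ℤ ℤ.+ sgn (proj₂ qw)) ℤD./ + 2) qs)

-- t = number of prime factors ≡ 5 (mod 12), with multiplicity.
-- Such primes are ≡ 1 (mod 4) and ≠ 2,3, hence occur only among the p_i.
tCount : List (ℕ × ℕ) → ℕ
tCount ps = sumℕ (map proj₂ (filter (λ pv → (proj₁ pv % 12) ≟ 5) ps))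

ValidP : ℕ × ℕ → Set
ValidP (p , v) = Prime p × (p % 4 ≡ 1) × (1 ≤ v)

ValidQ : ℕ × ℕ → Set
ValidQ (q , w) = Prime q × (q % 4 ≡ 3) × (3 ℕ.< q) × (1 ≤ w)

{-# OPTIONS --safe #-}
-- Write R n for the set of (u , v) with u² + v² = n.  Since x² + 9y² = x² + (3y)² and
-- 2x² + 2xy + 5y² = (x − y)² + (x + 2y)², the two forms count the elements of R n with
-- 3 ∣ v and with 3 ∣ v − u respectively.  If 3 ∣ n, every element of R n has both properties.
-- If n ≡ 1 (mod 3), then exactly one of u, v is divisible by 3 and never 3 ∣ v − u; if
-- n ≡ 2 (mod 3), then exactly one of v − u, v + u is divisible by 3 and never 3 ∣ v; so by
-- symmetry one form takes half of R n and the other nothing.  On the support of Λ the residue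
-- of n modulo 3 is (−1)^(a+t).
-- The size of R n is built up one prime at a time, starting from the four units of ℤ[i]:
-- the prime 2 changes nothing; a prime q ≡ 3 (mod 4) dividing a norm divides the Gaussian
-- integer, so R (q² m) ≅ R m and R (q m) = ∅ when q ∤ m; for p = π π̄ and p ∤ m,
-- R (p^(v+1) m) is the disjoint union of π R (p^v m) and π̄^(v+1) R m.
-- Both facts on primes come from one parity principle, that a finite set with a perfect
-- matching has even size: with Zagier's involution it makes p ≡ 1 (mod 4) a sum of two
-- squares, and with the relation q ∣ a² + b² on {1, …, (q−1)/2} it shows that −1 is not a
-- square modulo q ≡ 3 (mod 4).
module Submission where

open import Defs
open import Data.Integer as ℤ using (ℤ; +_)
open import Data.List using (List; []; _∷_; _++_; length; map; filter; upTo; applyUpTo; cartesianProduct)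
open import Data.List.Properties using (length-map; length-++; length-applyUpTo; filter-accept; filter-reject)
open import Data.List.Membership.Propositional using (_∈_; find)
open import Data.List.Membership.Propositional.Properties
open import Data.List.Relation.Unary.All as All using (All; []; _∷_)
open import Data.List.Relation.Unary.AllPairs using ([]; _∷_)
open import Data.List.Relation.Unary.Any as Any using (here; there; any?)
open import Data.List.Relation.Unary.Unique.Propositional using (Unique)
open import Data.List.Relation.Unary.Unique.Propositional.Properties
open import Data.Nat.Primality using (Prime; prime?; prime[2]; ¬prime[0]; ¬prime[1]; euclidsLemma; prime⇒irreducible; prime⇒nonZero)
open import Data.Product using (_×_; _,_; ∃; ∃₂; proj₁; proj₂; swap)
open import Data.Product.Properties using (≡-dec)
open import Data.Sum as Sum using (_⊎_; inj₁; inj₂; [_,_]′; reduce)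
open import Function using (_∘_; id; case_of_)
open import Function.Bundles using (_⇔_; mk⇔; Equivalence)
open import Relation.Binary.Definitions using (tri<; tri≈; tri>; DecidableEquality)
open import Relation.Binary.PropositionalEquality
open import Relation.Nullary using (¬_; contradiction; ¬?; yes; no)
open import Relation.Nullary.Decidable using (from-yes; from-no)
open import Relation.Unary using (Decidable)

-- Finite counts, their transport along bijections, and the parity of perfectly matched sets.

module Counting where

  open import Data.Nat using (suc; _+_; _≤_; z≤n; s≤s)
  open import Data.Nat.Properties using (≤-trans; n≤1+n; ≤-reflexive; ≤-antisym)
  open import Data.Nat.Divisibility using (_∣_; ∣m∣n⇒∣m+n; ∣-refl; _∣0)
  open import Data.Integer.Properties using (pos-+)
  open import Data.List.Relation.Binary.Permutation.Propositional using (_↭_; ↭-sym; ↭⇒↭ₛ)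
  open import Data.List.Relation.Binary.Permutation.Propositional.Properties using (shift; ↭-length; ∈-resp-↭)
  import Data.List.Relation.Binary.Permutation.Setoid.Properties as Permutation

  open Equivalence public using (to; from)

  private variable
    A B : Set

  extract : {x : A} {xs : List A} → Unique xs → x ∈ xs → ∃ λ ys → Unique (x ∷ ys) × xs ↭ x ∷ ys
  extract uq x∈xs with ∈-∃++ x∈xs
  ... | ys , zs , refl =
    ys ++ zs , Permutation.Unique-resp-↭ (setoid _) (↭⇒↭ₛ (shift _ ys zs)) uq , shift _ ys zs

  length-mono : (xs {ys} : List A) → Unique xs → Unique ys → (∀ {x} → x ∈ xs → x ∈ ys) → length xs ≤ length ys
  length-mono []       _            _   _   = z≤n
  length-mono (x ∷ xs) u@(_ ∷ uq) uq′ sub with extract uq′ (sub (here refl))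
  ... | zs , (_ ∷ uzs) , p = ≤-trans (s≤s (length-mono xs uq uzs sub′)) (≤-reflexive (sym (↭-length p)))
    where
    sub′ : ∀ {y} → y ∈ xs → y ∈ zs
    sub′ y∈xs with ∈-resp-↭ p (sub (there y∈xs))
    ... | here refl  = contradiction y∈xs (Unique[x∷xs]⇒x∉xs u)
    ... | there y∈zs = y∈zs

  -- A fixed-point-free involution presented as a relation, with its laws stated among members of
  -- `xs`. This form suits both a map given by cases and a congruence such as q ∣ a² + b².
  record Matching {A : Set} (_~_ : A → A → Set) (xs : List A) : Set where
    field
      symmetric  : ∀ {x y} → x ∈ xs → y ∈ xs → x ~ y → y ~ x
      functional : ∀ {x y z} → x ∈ xs → y ∈ xs → z ∈ xs → x ~ y → x ~ z → y ≡ z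
      partner    : ∀ {x} → x ∈ xs → ∃ λ y → y ∈ xs × y ≢ x × x ~ y

  -- Removing x and its partner y leaves a matched list, since anything matched with one of them is
  -- the other. The bound `k` carries the recursion, because the list that remains is not a subterm.
  matching⇒even : ∀ {_~_ : A → A → Set} k xs → length xs ≤ k → Unique xs → Matching _~_ xs → 2 ∣ length xs
  matching⇒even k [] _ _ _ = 2 ∣0
  matching⇒even {_~_ = _~_} (suc k) (x ∷ xs) (s≤s l) u@(_ ∷ uq) M
    with Matching.partner M (here refl)
  ... | _ , here refl , y≢x , _ = contradiction refl y≢x
  ... | y , there y∈xs , y≢x , x~y with extract uq y∈xs
  ... | zs , uzs@(_ ∷ uq′) , p rewrite ↭-length p =
    ∣m∣n⇒∣m+n ∣-refl (matching⇒even k zs (≤-trans (n≤1+n _) l) uq′ M′)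
    where
    open Matching M
    up : ∀ {z} → z ∈ zs → z ∈ x ∷ xs
    up z∈zs = there (∈-resp-↭ (↭-sym p) (there z∈zs))
    x∉ : ∀ {z} → z ∈ zs → x ~ z → z ≡ y
    x∉ z∈zs x~z = functional (here refl) (up z∈zs) (there y∈xs) x~z x~y
    partner′ : ∀ {z} → z ∈ zs → ∃ λ w → w ∈ zs × w ≢ z × z ~ w
    partner′ {z} z∈zs with partner (up z∈zs)
    ... | _ , here refl , w≢z , z~w =
      contradiction (subst (_∈ zs) (x∉ z∈zs (symmetric (up z∈zs) (here refl) z~w)) z∈zs) (Unique[x∷xs]⇒x∉xs uzs)
    ... | w , there w∈xs , w≢z , z~w with ∈-resp-↭ p w∈xs
    ... | there w∈zs = w , w∈zs , w≢z , z~w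
    ... | here refl  =
      contradiction
        (subst (_∈ xs) (functional (there y∈xs) (up z∈zs) (here refl) (symmetric (up z∈zs) (there y∈xs) z~w)
          (symmetric (here refl) (there y∈xs) x~y)) (∈-resp-↭ (↭-sym p) (there z∈zs)))
        (Unique[x∷xs]⇒x∉xs u)
    M′ : Matching _~_ zs
    M′ = record
      { symmetric  = λ i j → symmetric (up i) (up j)
      ; functional = λ i j l → functional (up i) (up j) (up l)
      ; partner    = partner′
      }

  -- RepNumber a b c n m unfolds to Count (λ z → form a b c z ≡ + n) m.
  Count : (A → Set) → ℤ → Set
  Count P m = ∃ λ L → Unique L × (∀ x → (x ∈ L) ⇔ P x) × (+ length L ≡ m)

  -- Counting one set in two ways yields an equation of sizes; the halving argument draws l + l = 4k
  -- from it.
  count-unique : {P : A → Set} {k l : ℤ} → Count P k → Count P l → k ≡ l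
  count-unique (L , uL , eL , refl) (M , uM , eM , refl) = cong +_ (≤-antisym
    (length-mono L uL uM (from (eM _) ∘ to (eL _)))
    (length-mono M uM uL (from (eL _) ∘ to (eM _))))

  count-∅ : {P : A → Set} → (∀ x → ¬ P x) → Count P (+ 0)
  count-∅ ¬P = [] , [] , (λ x → mk⇔ (λ ()) (λ Px → contradiction Px (¬P x))) , refl

  count-bij : {P : A → Set} {Q : B → Set} {k : ℤ} (f : A → B) → (∀ {x y} → f x ≡ f y → x ≡ y) →
    (∀ x → P x → Q (f x)) → (∀ y → Q y → ∃ λ x → P x × y ≡ f x) → Count P k → Count Q k
  count-bij {P = P} {Q} f inj f⁺ f⁻ (L , uq , e , refl) =
    map f L , map⁺ inj uq , (λ y → mk⇔ (⇒ y) (⇐ y)) , cong +_ (length-map f L)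
    where
    ⇒ : ∀ y → y ∈ map f L → Q y
    ⇒ y y∈ with ∈-map⁻ f y∈
    ... | x , x∈ , refl = f⁺ x (to (e x) x∈)
    ⇐ : ∀ y → Q y → y ∈ map f L
    ⇐ y Qy with f⁻ y Qy
    ... | x , Px , refl = ∈-map⁺ f (from (e x) Px)

  preimages : (f : A → B) (ys : List B) → (∀ {y} → y ∈ ys → ∃ λ x → y ≡ f x) → ∃ λ xs → ys ≡ map f xs
  preimages f []       _ = [] , refl
  preimages f (y ∷ ys) h with h (here refl) | preimages f ys (h ∘ there)
  ... | x , refl | xs , refl = x ∷ xs , refl

  -- Pulls an enumeration back along `f`. It carries counts of pairs (u , v) under a congruence over
  -- to the quadratic forms.
  count-bij⁻ : {P : A → Set} {Q : B → Set} {k : ℤ} (f : A → B) → (∀ {x y} → f x ≡ f y → x ≡ y) →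
    (∀ x → P x → Q (f x)) → (∀ y → Q y → ∃ λ x → P x × y ≡ f x) → Count Q k → Count P k
  count-bij⁻ {P = P} f inj f⁺ f⁻ (L , uq , e , refl)
    with preimages f L (λ {y} y∈ → let (x , _ , y≡fx) = f⁻ y (to (e y) y∈) in x , y≡fx)
  ... | K , refl = K , map⁻ uq , (λ x → mk⇔ (⇒ x) (⇐ x)) , cong +_ (sym (length-map f K))
    where
    ⇒ : ∀ x → x ∈ K → P x
    ⇒ x x∈ with f⁻ (f x) (to (e (f x)) (∈-map⁺ f x∈))
    ... | x′ , Px′ , eq = subst P (sym (inj eq)) Px′
    ⇐ : ∀ x → P x → x ∈ K
    ⇐ x Px with ∈-map⁻ f (from (e (f x)) (f⁺ x Px))
    ... | x′ , x′∈ , eq = subst (_∈ K) (sym (inj eq)) x′∈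

  count-cong : {P Q : A → Set} {k : ℤ} → (∀ x → P x → Q x) → (∀ x → Q x → P x) → Count P k → Count Q k
  count-cong ⇒ ⇐ = count-bij id id ⇒ (λ y Qy → y , ⇐ y Qy , refl)

  count-⊎ : {P Q : A → Set} {k l : ℤ} → (∀ x → P x → ¬ Q x) →
    Count P k → Count Q l → Count (λ x → P x ⊎ Q x) (k ℤ.+ l)
  count-⊎ disj (L , uL , eL , refl) (M , uM , eM , refl) =
    L ++ M ,
    ++⁺ uL uM (λ {x} (x∈L , x∈M) → disj x (to (eL x) x∈L) (to (eM x) x∈M)) ,
    (λ x → mk⇔ ([ inj₁ ∘ to (eL x) , inj₂ ∘ to (eM x) ]′ ∘ ∈-++⁻ L)
               [ ∈-++⁺ˡ ∘ from (eL x) , ∈-++⁺ʳ L ∘ from (eM x) ]′) ,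
    trans (cong +_ (length-++ L)) (pos-+ (length L) (length M))

  count-filter : {P Q : A → Set} {k : ℤ} → Decidable Q → Count P k → ∃ λ l → Count (λ x → P x × Q x) l
  count-filter Q? (L , uL , eL , _) = _ , filter Q? L , filter⁺ Q? uL ,
    (λ x → mk⇔ (λ x∈ → let (x∈L , Qx) = ∈-filter⁻ Q? x∈ in to (eL x) x∈L , Qx)
               (λ (Px , Qx) → ∈-filter⁺ Q? (from (eL x) Px) Qx)) , refl

-- Divisibility in ℤ and inverses modulo a prime.

module IntegerDivisibility where

  open import Data.Nat as ℕ using ()
  import Data.Nat.Properties as ℕ
  import Data.Nat.Divisibility as ℕ
  open import Data.Nat.GCD using (module Bézout)
  open import Data.Nat.Coprimality using (Coprime; coprime-Bézout)
  open import Data.Integer using (+_; -[1+_]; -_; _+_; _*_; _-_; 1ℤ) renaming (∣_∣ to abs)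
  open import Data.Integer.Properties
  open import Data.Integer.Divisibility.Signed
  open import Data.Integer.Tactic.RingSolver using (solve-∀)

  ∣-combination : ∀ {k m n t} r s → k ∣ m → k ∣ n → t ≡ r * m + s * n → k ∣ t
  ∣-combination r s k∣m k∣n refl = ∣m∣n⇒∣m+n (∣n⇒∣m*n r k∣m) (∣n⇒∣m*n s k∣n)

  ∣-multiple : ∀ {k m t} r → k ∣ m → t ≡ r * m → k ∣ t
  ∣-multiple r k∣m refl = ∣n⇒∣m*n r k∣m

  ∣-pos⁺ : ∀ {m n} → m ℕ.∣ n → + m ∣ + n
  ∣-pos⁺ = ∣ᵤ⇒∣

  ∣-pos⁻ : ∀ {m n} → + m ∣ + n → m ℕ.∣ n
  ∣-pos⁻ = ∣⇒∣ᵤ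

  euclid : ∀ {p} → Prime p → ∀ i j → + p ∣ i * j → + p ∣ i ⊎ + p ∣ j
  euclid pr i j p∣ij = Sum.map ∣ᵤ⇒∣ ∣ᵤ⇒∣ (euclidsLemma (abs i) (abs j) pr (subst (_ ℕ.∣_) (abs-* i j) (∣⇒∣ᵤ p∣ij)))

  prime∣square : ∀ {p} → Prime p → ∀ i → + p ∣ i * i → + p ∣ i
  prime∣square pr i = reduce ∘ euclid pr i i

  prime∤1 : ∀ {p} → Prime p → ¬ + p ∣ 1ℤ
  prime∤1 pr p∣1 with refl ← ℕ.∣1⇒≡1 (∣⇒∣ᵤ p∣1) = ¬prime[1] pr

  prime∤⇒coprime : ∀ {p n} → Prime p → ¬ p ℕ.∣ n → Coprime n p
  prime∤⇒coprime pr p∤n (d∣n , d∣p) with prime⇒irreducible pr d∣p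
  ... | inj₁ d≡1  = d≡1
  ... | inj₂ refl = contradiction d∣n p∤n

  inverse-pos : ∀ {p} → Prime p → ∀ n → ¬ p ℕ.∣ n → ∃ λ w → + p ∣ w * + n - 1ℤ
  inverse-pos {p} pr n p∤n with coprime-Bézout (prime∤⇒coprime pr p∤n)
  ... | Bézout.+- x y eq = + x , divides (+ y) (begin
    + x * + n - 1ℤ            ≡⟨ cong (_- 1ℤ) (sym (pos-* x n)) ⟩
    + (x ℕ.* n) - 1ℤ          ≡⟨ cong (λ m → + m - 1ℤ) (sym eq) ⟩
    1ℤ + + (y ℕ.* p) - 1ℤ     ≡⟨ f (+ (y ℕ.* p)) ⟩
    + (y ℕ.* p)               ≡⟨ pos-* y p ⟩
    + y * + p                 ∎)
    where
    open ≡-Reasoning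
    f : ∀ m → 1ℤ + m - 1ℤ ≡ m
    f = solve-∀
  -- This Bézout identity reads 1 + x n = y p, so -x is the inverse.
  ... | Bézout.-+ x y eq = - + x , divides (- + y) (begin
    - + x * + n - 1ℤ          ≡⟨ f (+ x) (+ n) ⟩
    - (1ℤ + + x * + n)        ≡⟨ cong (λ m → - (1ℤ + m)) (sym (pos-* x n)) ⟩
    - + (1 ℕ.+ x ℕ.* n)       ≡⟨ cong (λ m → - + m) eq ⟩
    - + (y ℕ.* p)             ≡⟨ cong -_ (pos-* y p) ⟩
    - (+ y * + p)             ≡⟨ neg-distribˡ-* (+ y) (+ p) ⟩
    - + y * + p               ∎)
    where
    open ≡-Reasoning
    f : ∀ x n → - x * n - 1ℤ ≡ - (1ℤ + x * n)
    f = solve-∀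

  inverse : ∀ {p} → Prime p → ∀ i → ¬ + p ∣ i → ∃ λ w → + p ∣ w * i - 1ℤ
  inverse pr (+ n) p∤i = inverse-pos pr n (p∤i ∘ ∣ᵤ⇒∣)
  inverse pr -[1+ n ] p∤i with w , d ← inverse-pos pr (ℕ.suc n) (p∤i ∘ ∣ᵤ⇒∣) = - w , subst (_ ∣_) (f w (+ ℕ.suc n)) d
    where
    f : ∀ w n → w * n - 1ℤ ≡ - w * - n - 1ℤ
    f = solve-∀

  -- The difference has absolute value below p, so a multiple of p can only be 0.
  ∣-difference⇒≡ : ∀ {p m n} → m ℕ.< p → n ℕ.< p → + p ∣ + m - + n → m ≡ n
  ∣-difference⇒≡ {p} {m} {n} m<p n<p d = +-injective (i-j≡0⇒i≡j (+ m) (+ n) (∣i∣≡0⇒i≡0 (zero-of (∣⇒∣ᵤ d) bound)))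
    where
    bound : abs (+ m - + n) ℕ.< p
    bound = ℕ.≤-<-trans (ℕ.≤-trans (ℕ.≤-reflexive (cong abs (m-n≡m⊖n m n))) (∣m⊝n∣≤m⊔n m n)) (ℕ.⊔-lub m<p n<p)
    zero-of : ∀ {k} → p ℕ.∣ k → k ℕ.< p → k ≡ 0
    zero-of {ℕ.zero}  _ _   = refl
    zero-of {ℕ.suc k} d k<p = contradiction d (ℕ.>⇒∤ k<p)

-- Primes p ≡ 1 (mod 4) are sums of two squares, by Zagier's argument.

module FermatTwoSquares where

  open import Data.Nat using (ℕ; zero; suc; _+_; _*_; _∸_; _%_; _/_; _<_; _≤_; z≤n; s≤s; z<s; _≟_; >-nonZero)
  open import Data.Nat.Properties
  open import Data.Nat.Divisibility using (_∣_; ∣m+n∣m⇒∣n; ∣⇒≤; m∣m*n)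
  open import Data.Nat.DivMod using (m≡m%n+[m/n]*n; m*n%n≡0)
  open import Data.Nat.Tactic.RingSolver using (solve-∀)
  open Counting

  <⇒+suc : ∀ {m n} → m < n → ∃ λ d → n ≡ m + suc d
  <⇒+suc {m} m<n with m≤n⇒∃[o]m+o≡n m<n
  ... | d , refl = d , sym (+-suc m d)

  prime-*⇒≡1 : ∀ {m n} → Prime (m * n) → m ≡ 1 ⊎ n ≡ 1
  prime-*⇒≡1 {m} {n} pr with prime⇒irreducible pr (m∣m*n n)
  ... | inj₁ m≡1 = inj₁ m≡1
  prime-*⇒≡1 {zero}  pr | inj₂ _ = contradiction pr ¬prime[0]
  prime-*⇒≡1 {suc m} {n} pr | inj₂ eq = inj₂ (*-cancelˡ-≡ n 1 (suc m) (sym (trans (*-identityʳ (suc m)) eq)))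

  ¬prime-square : ∀ m → ¬ Prime (m * m)
  ¬prime-square m pr with prime-*⇒≡1 {m} pr
  ... | inj₁ refl = ¬prime[1] pr
  ... | inj₂ refl = ¬prime[1] pr

  m≤m*m : ∀ m → m ≤ m * m
  m≤m*m zero    = z≤n
  m≤m*m (suc m) = m≤m*n (suc m) (suc m)

  -- Zagier's involution, as the relation matching each triple with its image.
  Triple : Set
  Triple = ℕ × ℕ × ℕ

  _≟ₜ_ : DecidableEquality Triple
  _≟ₜ_ = ≡-dec _≟_ (≡-dec _≟_ _≟_)

  -- The branches y > x + z, then y < x + z with x < 2y, then x > 2y, written additively to avoid
  -- subtraction in ℕ; the separating inequalities come from positivity of the entries. `high` is
  -- the converse of `low`.
  data _~_ : Triple → Triple → Set where
    low  : ∀ {x y z x′ y′ z′} → x′ ≡ x + 2 * z → y′ ≡ z → y ≡ x + z + z′ → (x , y , z) ~ (x′ , y′ , z′)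
    mid  : ∀ {x y z x′ y′ z′} → x + x′ ≡ 2 * y → y′ ≡ y → x + z ≡ y + z′ → (x , y , z) ~ (x′ , y′ , z′)
    high : ∀ {x y z x′ y′ z′} → x ≡ x′ + 2 * z′ → y ≡ z′ → y′ ≡ x′ + z′ + z → (x , y , z) ~ (x′ , y′ , z′)

  mid-sym : ∀ {x y z x′ z′} → x + x′ ≡ 2 * y → x + z ≡ y + z′ → x′ + z′ ≡ y + z
  mid-sym {x} {y} {z} {x′} {z′} e₁ e₂ = +-cancelˡ-≡ (x + y) _ _ (begin
    x + y + (x′ + z′)   ≡⟨ r₁ x y x′ z′ ⟩
    x + x′ + (y + z′)   ≡⟨ cong₂ _+_ e₁ (sym e₂) ⟩
    2 * y + (x + z)     ≡⟨ r₂ x y z ⟩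
    x + y + (y + z)     ∎)
    where
    open ≡-Reasoning
    r₁ : ∀ x y x′ z′ → x + y + (x′ + z′) ≡ x + x′ + (y + z′)
    r₁ = solve-∀
    r₂ : ∀ x y z → 2 * y + (x + z) ≡ x + y + (y + z)
    r₂ = solve-∀

  ~-sym : ∀ {s t} → s ~ t → t ~ s
  ~-sym (low a b c)   = high a b c
  ~-sym (high a b c)  = low a b c
  ~-sym {x , y , z} {x′ , _ , z′} (mid a refl c) = mid (trans (+-comm x′ x) a) refl (mid-sym {x} {y} {z} {x′} {z′} a c)

  module Zagier (p : ℕ) (p-prime : Prime p) (p%4≡1 : p % 4 ≡ 1) where

    S : Triple → Set
    S (x , y , z) = x * x + 4 * (y * z) ≡ p

    -- Rules out x = 0 and x = 2y, each of which would make x² + 4yz a multiple of 4.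
    ≢4* : ∀ m → 4 * m ≢ p
    ≢4* m refl = contradiction (trans (sym p%4≡1) (trans (cong (_% 4) (*-comm 4 m)) (m*n%n≡0 m 4))) λ ()

    record Positive (t : Triple) : Set where
      constructor positive
      field
        x>0 : 0 < proj₁ t
        y>0 : 0 < proj₁ (proj₂ t)
        z>0 : 0 < proj₂ (proj₂ t)

    square+0 : ∀ x m → m ≡ 0 → x * x + 4 * m ≢ p
    square+0 x _ refl eq = ¬prime-square x (subst Prime (trans (sym eq) (+-identityʳ _)) p-prime)

    S⇒positive : ∀ t → S t → Positive t
    S⇒positive (zero , y , z) s           = contradiction s (≢4* (y * z))
    S⇒positive (suc x , zero , z) s       = contradiction s (square+0 (suc x) 0 refl)
    S⇒positive (suc x , suc y , zero) s   = contradiction s (square+0 (suc x) _ (*-zeroʳ y))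
    S⇒positive (suc x , suc y , suc z) s  = positive z<s z<s z<s

    private
      shift-ring : ∀ x z d → (x + 2 * z) * (x + 2 * z) + 4 * (z * d) ≡ x * x + 4 * ((x + z + d) * z)
      shift-ring = solve-∀

    low-S : ∀ {x z d} → S (x , x + z + d , z) → S (x + 2 * z , z , d)
    low-S {x} {z} {d} s = trans (shift-ring x z d) s

    high-S : ∀ {x z d} → S (x + 2 * z , z , d) → S (x , x + z + d , z)
    high-S {x} {z} {d} s = trans (sym (shift-ring x z d)) s

    mid-S : ∀ {x y z x′ z′} → x + x′ ≡ 2 * y → x + z ≡ y + z′ → S (x , y , z) → S (x′ , y , z′)
    -- Adding x x′ to both sides produces the factor x + x′ = 2y.
    mid-S {x} {y} {z} {x′} {z′} e₁ e₂ s = trans (+-cancelˡ-≡ (x * x′) _ _ (begin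
      x * x′ + (x′ * x′ + 4 * (y * z′))  ≡⟨ r₁ x x′ y z′ ⟩
      (x + x′) * x′ + 4 * (y * z′)       ≡⟨ cong (λ u → u * x′ + 4 * (y * z′)) e₁ ⟩
      2 * y * x′ + 4 * (y * z′)          ≡⟨ r₂ y x′ z′ ⟩
      2 * y * (x′ + z′ + z′)             ≡⟨ cong (λ u → 2 * y * (u + z′)) (mid-sym {x} {y} {z} {x′} {z′} e₁ e₂) ⟩
      2 * y * (y + z + z′)               ≡⟨ cong (2 * y *_) (r₄ y z z′) ⟩
      2 * y * (y + z′ + z)               ≡⟨ cong (λ u → 2 * y * (u + z)) (sym e₂) ⟩
      2 * y * (x + z + z)                ≡⟨ sym (r₂ y x z) ⟩
      2 * y * x + 4 * (y * z)            ≡⟨ cong (λ u → u * x + 4 * (y * z)) (sym e₁) ⟩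
      (x + x′) * x + 4 * (y * z)         ≡⟨ r₃ x x′ y z ⟩
      x * x′ + (x * x + 4 * (y * z))     ∎)) s
      where
      open ≡-Reasoning
      r₁ : ∀ x x′ y z′ → x * x′ + (x′ * x′ + 4 * (y * z′)) ≡ (x + x′) * x′ + 4 * (y * z′)
      r₁ = solve-∀
      r₂ : ∀ y x′ z′ → 2 * y * x′ + 4 * (y * z′) ≡ 2 * y * (x′ + z′ + z′)
      r₂ = solve-∀
      r₃ : ∀ x x′ y z → (x + x′) * x + 4 * (y * z) ≡ x * x′ + (x * x + 4 * (y * z))
      r₃ = solve-∀
      r₄ : ∀ y z z′ → y + z + z′ ≡ y + z′ + z
      r₄ = solve-∀

    -- The branches miss only two boundaries, and these carry no solution: y = x + z makes p the
    -- square of x + 2z, and x = 2y makes p a multiple of 4.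
    ~-total : ∀ t → S t → ∃ λ t′ → S t′ × t ~ t′
    ~-total (x , y , z) s with <-cmp (x + z) y
    ... | tri< lt _ _ with <⇒+suc lt
    ... | d , refl = (x + 2 * z , z , suc d) , low-S {x} {z} s , low refl refl refl
    ~-total (x , y , z) s | tri≈ _ refl _ =
      contradiction (subst Prime (trans (sym s) (sq x z)) p-prime) (¬prime-square (x + 2 * z))
      where
      sq : ∀ x z → x * x + 4 * ((x + z) * z) ≡ (x + 2 * z) * (x + 2 * z)
      sq = solve-∀
    ~-total (x , y , z) s | tri> _ _ gt with <-cmp (2 * y) x | <⇒+suc gt
    ... | tri< lt _ _ | _ with <⇒+suc lt
    ... | e , refl = (suc e , suc e + y + z , y) ,
        high-S {suc e} {y} (subst (λ u → S (u , y , z)) (+-comm (2 * y) (suc e)) s) ,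
        high (+-comm (2 * y) (suc e)) refl refl
    ~-total (x , y , z) s | tri> _ _ gt | tri≈ _ refl _ | _ = contradiction (trans (f y z) s) (≢4* (y * y + y * z))
      where
      f : ∀ y z → 4 * (y * y + y * z) ≡ 2 * y * (2 * y) + 4 * (y * z)
      f = solve-∀
    ~-total (x , y , z) s | tri> _ _ gt | tri> _ _ lt | z′ , eq =
      (2 * y ∸ x , y , suc z′) , mid-S {x} {y} {z} e eq s , mid e refl eq
      where
      e : x + (2 * y ∸ x) ≡ 2 * y
      e = m+[n∸m]≡n (<⇒≤ lt)

    low≁mid : ∀ {x y z z′ z″} → 0 < z′ → y ≡ x + z + z′ → x + z ≢ y + z″
    low≁mid {x} {y} {z} {z′} {z″} z′>0 refl e = <⇒≢ (begin-strict
      x + z            <⟨ m<m+n (x + z) z′>0 ⟩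
      x + z + z′       ≤⟨ m≤m+n _ z″ ⟩
      x + z + z′ + z″  ∎) e
      where open ≤-Reasoning

    low≁high : ∀ x″ y {x z z′} → 0 < z → y ≡ x + z + z′ → x ≢ x″ + 2 * y
    low≁high x″ y {x} {z} {z′} z>0 e e′ = <⇒≢ (begin-strict
      y               ≤⟨ m≤m+n y (y + 0) ⟩
      2 * y           ≤⟨ m≤n+m _ x″ ⟩
      x″ + 2 * y      ≡⟨ sym e′ ⟩
      x               <⟨ m<m+n x z>0 ⟩
      x + z           ≤⟨ m≤m+n (x + z) z′ ⟩
      x + z + z′      ∎) e
      where open ≤-Reasoning

    mid≁high : ∀ x″ y {x x′} → 0 < x′ → x + x′ ≡ 2 * y → x ≢ x″ + 2 * y
    mid≁high x″ y {x} {x′} x′>0 e e′ = >⇒≢ (begin-strict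
      2 * y       ≤⟨ m≤n+m _ x″ ⟩
      x″ + 2 * y  ≡⟨ sym e′ ⟩
      x           <⟨ m<m+n x x′>0 ⟩
      x + x′      ∎) e
      where open ≤-Reasoning

    -- Within one branch the image is determined by cancellation; two distinct branches contradict
    -- each other through the strict inequalities that positivity gives.
    ~-functional : ∀ {s t u} → Positive s → Positive t → Positive u → s ~ t → s ~ u → t ≡ u
    ~-functional {x , y , z} _ _ _ (low {z′ = a} refl refl e) (low {z′ = b} refl refl e′)
      with refl ← +-cancelˡ-≡ (x + z) a b (trans (sym e) e′) = refl
    ~-functional {x , y , z} _ _ _ (mid {x′ = a} {z′ = b} e refl f) (mid {x′ = a′} {z′ = b′} e′ refl f′)
      with refl ← +-cancelˡ-≡ x a a′ (trans e (sym e′)) | refl ← +-cancelˡ-≡ y b b′ (trans (sym f) f′) = refl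
    ~-functional {x , y , z} _ _ _ (high {x′ = a} e refl refl) (high {x′ = b} e′ refl refl)
      with refl ← +-cancelʳ-≡ (2 * y) a b (trans (sym e) e′) = refl
    ~-functional {x} _ t _ (low _ _ e) (mid _ _ f)        = contradiction f (low≁mid {proj₁ x} (Positive.z>0 t) e)
    ~-functional {x} _ _ u (mid _ _ f) (low _ _ e)        = contradiction f (low≁mid {proj₁ x} (Positive.z>0 u) e)
    ~-functional s _ _ (low _ _ e) (high {y = y} {x′ = a} f refl _)    = contradiction f (low≁high a y (Positive.z>0 s) e)
    ~-functional s _ _ (high {y = y} {x′ = a} f refl _) (low _ _ e)    = contradiction f (low≁high a y (Positive.z>0 s) e)
    ~-functional _ t _ (mid e _ _) (high {y = y} {x′ = a} f refl _)    = contradiction f (mid≁high a y (Positive.x>0 t) e)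
    ~-functional _ _ u (high {y = y} {x′ = a} f refl _) (mid e _ _)    = contradiction f (mid≁high a y (Positive.x>0 u) e)

    k : ℕ
    k = p / 4

    t₀ : Triple
    t₀ = 1 , 1 , k

    p≡1+4k : p ≡ 1 + 4 * k
    p≡1+4k = trans (m≡m%n+[m/n]*n p 4) (cong₂ _+_ p%4≡1 (*-comm k 4))

    S-t₀ : S t₀
    S-t₀ = trans (cong (λ m → 1 + 4 * m) (*-identityˡ k)) (sym p≡1+4k)

    ~-t₀ : t₀ ~ t₀
    ~-t₀ = mid refl refl refl

    -- `low` and `high` change x. In `mid` a fixed triple has x = y, so p = x (x + 4z), and
    -- primality forces x = 1.
    ~-fixed : ∀ {t} → S t → t ~ t → t ≡ t₀
    ~-fixed {x , y , z} s (low e _ _) with positive _ _ z>0 ← S⇒positive (x , y , z) s =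
      contradiction e (<⇒≢ (m<m+n x (≤-trans z>0 (m≤m+n z (z + 0)))))
    ~-fixed {x , y , z} s (high e _ _) with positive _ _ z>0 ← S⇒positive (x , y , z) s =
      contradiction e (<⇒≢ (m<m+n x (≤-trans z>0 (m≤m+n z (z + 0)))))
    ~-fixed {x , y , z} s (mid e _ _) with positive x>0 _ z>0 ← S⇒positive (x , y , z) s
      with refl ← *-cancelˡ-≡ x y 2 (trans (cong (λ u → x + u) (+-identityʳ x)) e)
      with prime-*⇒≡1 {x} {x + 4 * z} (subst Prime (trans (sym s) (f x z)) p-prime)
      where
      f : ∀ x z → x * x + 4 * (x * z) ≡ x * (x + 4 * z)
      f = solve-∀
    ... | inj₁ refl = cong (λ m → 1 , 1 , m)
      (*-cancelˡ-≡ z k 4 (trans (cong (4 *_) (sym (*-identityˡ z))) (suc-injective (trans s p≡1+4k))))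
    ... | inj₂ e′   = contradiction (sym e′) (<⇒≢ (+-mono-≤ x>0 (≤-trans z>0 (m≤m+n z (3 * z)))))

    box : List Triple
    box = cartesianProduct (upTo (suc p)) (cartesianProduct (upTo (suc p)) (upTo (suc p)))

    -- All entries are at most p, because x ≤ x² and y, z ≤ y z.
    ∈-box : ∀ t → S t → t ∈ box
    ∈-box (x , y , z) s with positive x>0 y>0 z>0 ← S⇒positive (x , y , z) s =
      ∈-cartesianProduct⁺ (∈-upTo⁺ (s≤s (≤-trans (m≤m*m x) (≤-trans (m≤m+n (x * x) _) (≤-reflexive s)))))
        (∈-cartesianProduct⁺
          (∈-upTo⁺ (s≤s (≤-trans (m≤m*n y z {{>-nonZero z>0}}) yz≤p)))
          (∈-upTo⁺ (s≤s (≤-trans (m≤n*m z y {{>-nonZero y>0}}) yz≤p))))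
      where
      yz≤p : y * z ≤ p
      yz≤p = ≤-trans (m≤m+n (y * z) _) (≤-trans (m≤n+m _ (x * x)) (≤-reflexive s))

    S? : Decidable S
    S? (x , y , z) = (x * x + 4 * (y * z)) ≟ p

    ≢t₀? : Decidable (_≢ t₀)
    ≢t₀? t = ¬? (t ≟ₜ t₀)

    others : List Triple
    others = filter ≢t₀? (filter S? box)

    others-unique : Unique others
    others-unique = filter⁺ ≢t₀? (filter⁺ S? {box}
      (cartesianProduct⁺ (upTo⁺ (suc p)) (cartesianProduct⁺ (upTo⁺ (suc p)) (upTo⁺ (suc p)))))

    ∈-others⁺ : ∀ t → S t → t ≢ t₀ → t ∈ others
    ∈-others⁺ t s = ∈-filter⁺ ≢t₀? (∈-filter⁺ S? (∈-box t s) s)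

    ∈-others⁻ : ∀ {t} → t ∈ others → S t × t ≢ t₀
    ∈-others⁻ t∈ with ∈-filter⁻ ≢t₀? {xs = filter S? box} t∈
    ... | t∈′ , ne = proj₂ (∈-filter⁻ S? {xs = box} t∈′) , ne

    pos : ∀ {t} → t ∈ others → Positive t
    pos t∈ = S⇒positive _ (proj₁ (∈-others⁻ t∈))

    others-even : 2 ∣ length others
    others-even = matching⇒even _ others ≤-refl others-unique record
      { symmetric  = λ _ _ → ~-sym
      ; functional = λ i j l → ~-functional (pos i) (pos j) (pos l)
      ; partner    = partner
      }
      where
      partner : ∀ {t} → t ∈ others → ∃ λ u → u ∈ others × u ≢ t × t ~ u
      partner {t} t∈ with s , t≢t₀ ← ∈-others⁻ t∈ with u , s′ , t~u ← ~-total t s =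
        -- The image u is not `t₀`: `t₀` is matched with itself, hence with no other triple.
        u ,
        ∈-others⁺ u s′ (λ { refl → t≢t₀ (~-functional (S⇒positive _ S-t₀) (pos t∈) (S⇒positive _ S-t₀) (~-sym t~u) ~-t₀) }) ,
        (λ { refl → t≢t₀ (~-fixed s t~u) }) , t~u

    all : List Triple
    all = t₀ ∷ others

    ∈-all⁻ : ∀ {t} → t ∈ all → S t
    ∈-all⁻ (here refl) = S-t₀
    ∈-all⁻ (there t∈)  = proj₁ (∈-others⁻ t∈)

    ∈-all⁺ : ∀ t → S t → t ∈ all
    ∈-all⁺ t s with t ≟ₜ t₀
    ... | yes refl = here refl
    ... | no ne    = there (∈-others⁺ t s ne)

    flip : Triple → Triple
    flip (x , y , z) = x , z , y

    flip-S : ∀ t → S t → S (flip t)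
    flip-S (x , y , z) s = trans (cong (λ m → x * x + 4 * m) (*-comm z y)) s

    -- A solution with y = z gives p = x² + (2y)². Without one, exchanging y and z would match `all`
    -- perfectly, yet `all` has one element more than the even list `others`.
    sum-of-squares : ∃₂ λ c d → p ≡ c * c + d * d
    sum-of-squares with any? (λ (x , y , z) → y ≟ z) all
    ... | yes any with (x , y , z) , t∈ , refl ← find any = x , 2 * y , trans (sym (∈-all⁻ t∈)) (f x y)
      where
      f : ∀ x y → x * x + 4 * (y * y) ≡ x * x + 2 * y * (2 * y)
      f = solve-∀
    ... | no none = contradiction (∣⇒≤ (∣m+n∣m⇒∣n 2∣ others-even)) λ { (s≤s ()) }
      where
      all-even : 2 ∣ length all
      all-even = matching⇒even {_~_ = λ t u → u ≡ flip t} _ all ≤-refl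
        (All.tabulate (λ t∈ eq → proj₂ (∈-others⁻ t∈) (sym eq)) ∷ others-unique) record
        { symmetric  = λ { _ _ refl → refl }
        ; functional = λ { _ _ _ refl refl → refl }
        ; partner    = λ { {t} t∈ → flip t , ∈-all⁺ (flip t) (flip-S t (∈-all⁻ t∈)) ,
                           (λ eq → none (Any.map (λ { refl → sym (cong (λ u → proj₁ (proj₂ u)) eq) }) t∈)) , refl }
        }
      2∣ : 2 ∣ length others + 1
      2∣ = subst (2 ∣_) (+-comm 1 (length others)) all-even

-- For primes q ≡ 3 (mod 4), -1 is not a square modulo q.

module MinusOneNonResidue where

  open import Data.Nat as ℕ using (ℕ; suc; z<s; s≤s)
  import Data.Nat.Properties as ℕ
  import Data.Nat.Divisibility as ℕ
  open import Data.Nat.DivMod using (m≡m%n+[m/n]*n)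
  import Data.Nat.Tactic.RingSolver as ℕ
  open import Data.Integer using (ℤ; +_; -_; _+_; _*_; _-_; 1ℤ)
  open import Data.Integer.Properties using (m-n≡m⊖n; ⊖-≥)
  open import Data.Integer.DivMod using (_%ℕ_; _/ℕ_; n%ℕd<d; a≡a%ℕn+[a/ℕn]*n)
  open import Data.Integer.Divisibility.Signed
  open import Data.Integer.Tactic.RingSolver using (solve-∀)
  open Counting
  open IntegerDivisibility

  module NonResidue (q : ℕ) (q-prime : Prime q) (q%4≡3 : q ℕ.% 4 ≡ 3) where

    -- This is (q - 1)/2, in a form that shows it to be odd.
    h : ℕ
    h = 1 ℕ.+ 2 ℕ.* (q ℕ./ 4)

    q≡1+2h : q ≡ 1 ℕ.+ 2 ℕ.* h
    q≡1+2h = trans (m≡m%n+[m/n]*n q 4) (trans (cong (ℕ._+ q ℕ./ 4 ℕ.* 4) q%4≡3) (f (q ℕ./ 4)))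
      where
      f : ∀ k → 3 ℕ.+ k ℕ.* 4 ≡ 1 ℕ.+ 2 ℕ.* (1 ℕ.+ 2 ℕ.* k)
      f = ℕ.solve-∀

    h<q : h ℕ.< q
    h<q = ℕ.≤-trans (s≤s (ℕ.m≤m+n h _)) (ℕ.≤-reflexive (sym q≡1+2h))

    q∤ : ∀ {m} → 0 ℕ.< m → m ℕ.< q → ¬ + q ∣ + m
    q∤ {suc m} _ m<q d = contradiction (∣⇒∣ᵤ d) (ℕ.>⇒∤ m<q)

    q∤2 : ¬ + q ∣ + 2
    q∤2 = q∤ z<s (ℕ.≤-trans (s≤s (s≤s (s≤s ℕ.z≤n))) (ℕ.≤-reflexive (sym q≡3+)))
      where
      f : ∀ k → 1 ℕ.+ 2 ℕ.* (1 ℕ.+ 2 ℕ.* k) ≡ 3 ℕ.+ 4 ℕ.* k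
      f = ℕ.solve-∀
      q≡3+ : q ≡ 3 ℕ.+ 4 ℕ.* (q ℕ./ 4)
      q≡3+ = trans q≡1+2h (f (q ℕ./ 4))

    -- Either the residue r of z is at most h, or q - r is, and the latter represents -z.
    least-residue : ∀ z → ∃ λ b → b ℕ.≤ h × (+ q ∣ + b - z ⊎ + q ∣ + b + z)
    least-residue z = cases (r ℕ.≤? h)
      where
      instance _ = prime⇒nonZero q-prime
      r = z %ℕ q
      k = z /ℕ q
      z≡ : z ≡ + r + k * + q
      z≡ = a≡a%ℕn+[a/ℕn]*n z q
      f : ∀ r k q → r - (r + k * q) ≡ - k * q
      f = solve-∀
      g : ∀ r k q → q - r + (r + k * q) ≡ (1ℤ + k) * q
      g = solve-∀
      cases : _ → ∃ λ b → b ℕ.≤ h × (+ q ∣ + b - z ⊎ + q ∣ + b + z)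
      cases (yes r≤h) = r , r≤h , inj₁ (divides (- k) (trans (cong (λ u → + r - u) z≡) (f (+ r) k (+ q))))
      cases (no r≰h)  = q ℕ.∸ r , ℕ.m≤n+o⇒m∸n≤o q r bound ,
        inj₂ (divides (1ℤ + k) (trans (cong₂ _+_ (sym (trans (m-n≡m⊖n q r) (⊖-≥ (ℕ.<⇒≤ (n%ℕd<d z q))))) z≡) (g (+ r) k (+ q))))
        where
        e : ∀ h → 1 ℕ.+ 2 ℕ.* h ≡ suc h ℕ.+ h
        e = ℕ.solve-∀
        bound : q ℕ.≤ r ℕ.+ h
        bound = ℕ.≤-trans (ℕ.≤-reflexive (trans q≡1+2h (e h))) (ℕ.+-monoˡ-≤ h (ℕ.≰⇒> r≰h))

    module _ (i : ℤ) (q∣i²+1 : + q ∣ i * i + 1ℤ) where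

      -- As i² ≡ -1, the relation amounts to b ≡ ± i a modulo q.
      _~_ : ℕ → ℕ → Set
      a ~ b = + q ∣ + a * + a + + b * + b

      half : List ℕ
      half = applyUpTo suc h

      ∈-half⁻ : ∀ {a} → a ∈ half → 0 ℕ.< a × a ℕ.≤ h
      ∈-half⁻ a∈ with _ , lt , refl ← ∈-applyUpTo⁻ suc a∈ = z<s , lt

      q∤-half : ∀ {a} → a ∈ half → ¬ + q ∣ + a
      q∤-half a∈ with 0<a , a≤h ← ∈-half⁻ a∈ = q∤ 0<a (ℕ.≤-<-trans a≤h h<q)

      q∤i : ¬ + q ∣ i
      q∤i q∣i = prime∤1 q-prime (∣m+n∣m⇒∣n q∣i²+1 (∣n⇒∣m*n i q∣i))

      -- Subtraction gives q ∣ (b - c)(b + c), and 0 < b + c ≤ 2h < q excludes the second factor.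
      functional : ∀ {a b c} → a ∈ half → b ∈ half → c ∈ half → a ~ b → a ~ c → b ≡ c
      functional {a} {b} {c} a∈ b∈ c∈ ab ac = bounded (∈-half⁻ b∈) (∈-half⁻ c∈)
        where
        f : ∀ a b c → a * a + b * b - (a * a + c * c) ≡ (b - c) * (b + c)
        f = solve-∀
        q≡ : q ≡ suc (h ℕ.+ h)
        q≡ = trans q≡1+2h (cong (λ m → suc (h ℕ.+ m)) (ℕ.+-identityʳ h))
        bounded : 0 ℕ.< b × b ℕ.≤ h → 0 ℕ.< c × c ℕ.≤ h → b ≡ c
        bounded (0<b , b≤h) (0<c , c≤h) =
          [ ∣-difference⇒≡ (ℕ.≤-<-trans b≤h h<q) (ℕ.≤-<-trans c≤h h<q)
          , (λ d → contradiction d (q∤ (ℕ.≤-trans 0<b (ℕ.m≤m+n b c))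
              (ℕ.≤-<-trans (ℕ.+-mono-≤ b≤h c≤h) (ℕ.≤-reflexive (sym q≡)))))
          ]′ (euclid q-prime (+ b - + c) (+ b + + c) (subst (+ q ∣_) (f (+ a) (+ b) (+ c)) (∣m∣n⇒∣m-n ab ac)))

      -- The partner is the representative of ± i a that is at most h. It is nonzero since q ∤ i a,
      -- and it differs from a since otherwise q ∣ 2a².
      partner : ∀ {a} → a ∈ half → ∃ λ b → b ∈ half × b ≢ a × a ~ b
      partner {a} a∈ with b , b≤h , d ← least-residue (i * + a) = b , b∈ b b≤h d , b≢a , a~b
        where
        q∤ia : ¬ + q ∣ i * + a
        q∤ia d with euclid q-prime i (+ a) d
        ... | inj₁ q∣i = q∤i q∣i
        ... | inj₂ q∣a = q∤-half a∈ q∣a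
        g₁ : ∀ x → x ≡ - 1ℤ * (+ 0 - x)
        g₁ = solve-∀
        g₂ : ∀ x → x ≡ 1ℤ * (+ 0 + x)
        g₂ = solve-∀
        b∈ : ∀ b → b ℕ.≤ h → + q ∣ + b - i * + a ⊎ + q ∣ + b + i * + a → b ∈ half
        b∈ (suc b) lt _ = ∈-applyUpTo⁺ suc lt
        b∈ 0 _ (inj₁ d) = contradiction (∣-multiple (- 1ℤ) d (g₁ (i * + a))) q∤ia
        b∈ 0 _ (inj₂ d) = contradiction (∣-multiple 1ℤ d (g₂ (i * + a))) q∤ia
        q∣diff : + q ∣ (+ b - i * + a) * (+ b + i * + a)
        q∣diff = [ ∣m⇒∣m*n (+ b + i * + a) , ∣n⇒∣m*n (+ b - i * + a) ]′ d
        f : ∀ a b i → a * a + b * b ≡ 1ℤ * ((b - i * a) * (b + i * a)) + a * a * (i * i + 1ℤ)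
        f = solve-∀
        a~b : a ~ b
        a~b = ∣-combination 1ℤ (+ a * + a) q∣diff q∣i²+1 (f (+ a) (+ b) i)
        b≢a : b ≢ a
        b≢a b≡a = [ q∤2 , q∤-half a∈ ∘ prime∣square q-prime (+ a) ]′
          (euclid q-prime (+ 2) (+ a * + a) (subst (+ q ∣_) (e (+ a)) (subst (a ~_) b≡a a~b)))
          where
          e : ∀ a → a * a + a * a ≡ + 2 * (a * a)
          e = solve-∀

      half-even : 2 ℕ.∣ length half
      half-even = matching⇒even _ half ℕ.≤-refl (applyUpTo⁺₁ suc h (λ i<j _ → ℕ.<⇒≢ (s≤s i<j))) record
        { symmetric  = λ {a} {b} _ _ → subst (+ q ∣_) (f (+ a) (+ b))
        ; functional = functional
        ; partner    = partner
        }
        where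
        f : ∀ a b → a * a + b * b ≡ b * b + a * a
        f = solve-∀

    -- A root of -1 would give `half` a perfect matching, but its size h is odd.
    ¬square-root : ∀ i → ¬ + q ∣ i * i + 1ℤ
    ¬square-root i d = contradiction (ℕ.∣⇒≤ {n = 1} (ℕ.∣m+n∣m⇒∣n (subst (2 ℕ.∣_) e (half-even i d)) (ℕ.m∣m*n (q ℕ./ 4)))) λ { (s≤s ()) }
      where
      e : length (half i d) ≡ 2 ℕ.* (q ℕ./ 4) ℕ.+ 1
      e = trans (length-applyUpTo suc h) (ℕ.+-comm 1 _)

    -- If q ∤ x and w inverts x, then (w y)² ≡ -1 modulo q.
    ∣-sum-of-squares : ∀ x y → + q ∣ x * x + y * y → + q ∣ x
    ∣-sum-of-squares x y d with + q ∣? x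
    ... | yes q∣x = q∣x
    ... | no q∤x with w , e ← inverse q-prime x q∤x =
      contradiction (∣-combination (w * w) (- (w * x + 1ℤ)) d e (f w x y)) (¬square-root (w * y))
      where
      f : ∀ w x y → w * y * (w * y) + 1ℤ ≡ w * w * (x * x + y * y) + - (w * x + 1ℤ) * (w * x - 1ℤ)
      f = solve-∀

-- Elements of given norm in ℤ[i], one prime power at a time.

module GaussianNorm where

  open import Data.Nat as ℕ using (ℕ; zero; suc)
  import Data.Nat.Properties as ℕ
  import Data.Nat.Divisibility as ℕ
  open import Data.Integer using (ℤ; +_; -_; _+_; _*_; _-_; 1ℤ; NonZero)
  open import Data.Integer.Properties
  open import Data.Integer.Divisibility.Signed
  open import Data.Integer.Tactic.RingSolver using (solve-∀)
  open import Data.Nat.Tactic.RingSolver using () renaming (solve-∀ to ℕ-solve-∀)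
  open Counting
  open IntegerDivisibility
  open FermatTwoSquares using (module Zagier)
  open MinusOneNonResidue using (module NonResidue)

  norm : ℤ × ℤ → ℤ
  norm (x , y) = x * x + y * y

  R : ℕ → ℤ × ℤ → Set
  R n z = norm z ≡ + n

  -- In ℤ[i]: mul c d z = z (c + d i), while z (c − d i) = dot c d z + (cross c d z) i.
  mul : ℤ → ℤ → ℤ × ℤ → ℤ × ℤ
  mul c d (x , y) = x * c - y * d , x * d + y * c

  dot cross : ℤ → ℤ → ℤ × ℤ → ℤ
  dot   c d (x , y) = x * c + y * d
  cross c d (x , y) = y * c - x * d

  norm-mul : ∀ c d z → norm (mul c d z) ≡ norm z * (c * c + d * d)
  norm-mul c d (x , y) = f c d x y
    where
    f : ∀ c d x y → (x * c - y * d) * (x * c - y * d) + (x * d + y * c) * (x * d + y * c) ≡ (x * x + y * y) * (c * c + d * d)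
    f = solve-∀

  dot-mul : ∀ c d z → dot c d (mul c d z) ≡ proj₁ z * (c * c + d * d)
  dot-mul c d (x , y) = f c d x y
    where
    f : ∀ c d x y → (x * c - y * d) * c + (x * d + y * c) * d ≡ x * (c * c + d * d)
    f = solve-∀

  cross-mul : ∀ c d z → cross c d (mul c d z) ≡ proj₂ z * (c * c + d * d)
  cross-mul c d (x , y) = f c d x y
    where
    f : ∀ c d x y → (x * d + y * c) * c - (x * c - y * d) * d ≡ y * (c * c + d * d)
    f = solve-∀

  module Factor (p : ℕ) (p-prime : Prime p) (c d : ℤ) (p≡ : + p ≡ c * c + d * d) where

    instance
      p≢0 : NonZero (+ p)
      p≢0 = prime⇒nonZero p-prime

    -- With π = c + d i this says π ∣ z, that is, p ∣ z π̄: the real part `dot` suffices because p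
    -- norm z = dot² + cross².
    D : ℤ × ℤ → Set
    D z = + p ∣ dot c d z

    norm-mul-p : ∀ z → norm (mul c d z) ≡ norm z * + p
    norm-mul-p z = trans (norm-mul c d z) (cong (norm z *_) (sym p≡))

    mul-injective : ∀ {z w} → mul c d z ≡ mul c d w → z ≡ w
    mul-injective {z} {w} eq = cong₂ _,_
      (*-cancelʳ-≡ (proj₁ z) (proj₁ w) (+ p) (trans (sym (d≡ z)) (trans (cong (dot c d) eq) (d≡ w))))
      (*-cancelʳ-≡ (proj₂ z) (proj₂ w) (+ p) (trans (sym (c≡ z)) (trans (cong (cross c d) eq) (c≡ w))))
      where
      d≡ : ∀ z → dot c d (mul c d z) ≡ proj₁ z * + p
      d≡ z = trans (dot-mul c d z) (cong (proj₁ z *_) (sym p≡))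
      c≡ : ∀ z → cross c d (mul c d z) ≡ proj₂ z * + p
      c≡ z = trans (cross-mul c d z) (cong (proj₂ z *_) (sym p≡))

    norm-identity : ∀ z → norm z * + p ≡ dot c d z * dot c d z + cross c d z * cross c d z
    norm-identity z@(x , y) = trans (cong (norm z *_) p≡) (f c d x y)
      where
      f : ∀ c d x y → (x * x + y * y) * (c * c + d * d) ≡ (x * c + y * d) * (x * c + y * d) + (y * c - x * d) * (y * c - x * d)
      f = solve-∀

    dot∣⇒cross∣ : ∀ z → D z → + p ∣ cross c d z
    dot∣⇒cross∣ z h = prime∣square p-prime (cross c d z) (∣m+n∣m⇒∣n {m = dot c d z * dot c d z}
      (subst (+ p ∣_) (norm-identity z) (∣n⇒∣m*n (norm z) ∣-refl)) (∣n⇒∣m*n (dot c d z) h))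

    cross∣⇒dot∣ : ∀ z → + p ∣ cross c d z → D z
    cross∣⇒dot∣ z h = prime∣square p-prime (dot c d z) (∣m+n∣n⇒∣m {m = dot c d z * dot c d z}
      (subst (+ p ∣_) (norm-identity z) (∣n⇒∣m*n (norm z) ∣-refl)) (∣n⇒∣m*n (cross c d z) h))

    D⇒∣norm : ∀ z → D z → + p ∣ norm z
    D⇒∣norm z h = go h (dot∣⇒cross∣ z h)
      where
      f : ∀ s t p → s * p * (s * p) + t * p * (t * p) ≡ (s * s + t * t) * p * p
      f = solve-∀
      go : D z → + p ∣ cross c d z → + p ∣ norm z
      go (divides s e) (divides t e′) = divides (s * s + t * t) (*-cancelʳ-≡ (norm z) ((s * s + t * t) * + p) (+ p)
        (trans (norm-identity z) (trans (cong₂ (λ u v → u * u + v * v) e e′) (f s t (+ p)))))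

    D-mul : ∀ z → D (mul c d z)
    D-mul z = divides (proj₁ z) (trans (dot-mul c d z) (cong (proj₁ z *_) (sym p≡)))

    -- From z π̄ = p (s + t i), multiplication by π gives p z = p (s + t i) π, and p cancels.
    mul-surjective : ∀ z → D z → ∃ λ w → z ≡ mul c d w
    mul-surjective z@(x , y) h = go h (dot∣⇒cross∣ z h)
      where
      f₁ : ∀ c d x y → x * (c * c + d * d) ≡ (x * c + y * d) * c - (y * c - x * d) * d
      f₁ = solve-∀
      f₂ : ∀ c d s t p → s * p * c - t * p * d ≡ (s * c - t * d) * p
      f₂ = solve-∀
      g₁ : ∀ c d x y → y * (c * c + d * d) ≡ (x * c + y * d) * d + (y * c - x * d) * c
      g₁ = solve-∀
      g₂ : ∀ c d s t p → s * p * d + t * p * c ≡ (s * d + t * c) * p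
      g₂ = solve-∀
      go : D z → + p ∣ cross c d z → ∃ λ w → z ≡ mul c d w
      go (divides s e) (divides t e′) = (s , t) , cong₂ _,_
        (*-cancelʳ-≡ x (s * c - t * d) (+ p) (trans (cong (x *_) p≡) (trans (f₁ c d x y)
          (trans (cong₂ (λ u v → u * c - v * d) e e′) (f₂ c d s t (+ p))))))
        (*-cancelʳ-≡ y (s * d + t * c) (+ p) (trans (cong (y *_) p≡) (trans (g₁ c d x y)
          (trans (cong₂ (λ u v → u * d + v * c) e e′) (g₂ c d s t (+ p))))))

    R-mul⁺ : ∀ m z → R m z → R (p ℕ.* m) (mul c d z)
    R-mul⁺ m z r = trans (norm-mul-p z) (trans (cong (_* + p) r) (trans (*-comm (+ m) (+ p)) (sym (pos-* p m))))

    R-mul⁻ : ∀ m z → R (p ℕ.* m) (mul c d z) → R m z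
    R-mul⁻ m z r = *-cancelʳ-≡ (norm z) (+ m) (+ p) (trans (sym (norm-mul-p z)) (trans r (trans (pos-* p m) (*-comm (+ p) (+ m)))))

    R-surjective : ∀ m z → R (p ℕ.* m) z → D z → ∃ λ w → R m w × z ≡ mul c d w
    R-surjective m z r h = w , R-mul⁻ m w (subst (R (p ℕ.* m)) (proj₂ q) r) , proj₂ q
      where
      q = mul-surjective z h
      w = proj₁ q

  -- Multiplication by 1 + i is onto: x² + y² ≡ (x + y)² modulo 2, so 1 + i divides every element of
  -- even norm.
  count-2* : ∀ {m k} → Count (R m) k → Count (R (2 ℕ.* m)) k
  count-2* {m} = count-bij (mul 1ℤ 1ℤ) mul-injective (R-mul⁺ m) back
    where
    open Factor 2 prime[2] 1ℤ 1ℤ refl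
    f : ∀ x y → (x * 1ℤ + y * 1ℤ) * (x * 1ℤ + y * 1ℤ) ≡ 1ℤ * (x * x + y * y) + (x * y) * + 2
    f = solve-∀
    back : ∀ z → R (2 ℕ.* m) z → ∃ λ w → R m w × z ≡ mul 1ℤ 1ℤ w
    back z@(x , y) r = R-surjective m z r (prime∣square prime[2] (dot 1ℤ 1ℤ z)
      (∣-combination 1ℤ (x * y) (subst (+ 2 ∣_) (sym r) (∣-pos⁺ (ℕ.m∣m*n m))) ∣-refl (f x y)))

  count-2^ : ∀ a {m k} → Count (R m) k → Count (R (2 ℕ.^ a ℕ.* m)) k
  count-2^ zero    {m} {k} C = subst (λ n → Count (R n) k) (sym (ℕ.*-identityˡ m)) C
  count-2^ (suc a) {m} {k} C = subst (λ n → Count (R n) k) (sym (ℕ.*-assoc 2 (2 ℕ.^ a) m)) (count-2* (count-2^ a C))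

  -- Split primes p = π π̄.

  module Split (p : ℕ) (p-prime : Prime p) (p∤2 : ¬ + p ∣ + 2) (c d : ℤ) (p≡ : + p ≡ c * c + d * d) where

    p≡̄ : + p ≡ c * c + - d * - d
    p≡̄ = trans p≡ (cong (λ u → c * c + u) (f d))
      where
      f : ∀ d → d * d ≡ - d * - d
      f = solve-∀

    module π = Factor p p-prime c d p≡
    module π̄ = Factor p p-prime c (- d) p≡̄
    open π using (D)

    -- Otherwise p ∣ c as well, and p² would divide c² + d² = p.
    p∤d : ¬ + p ∣ d
    p∤d p∣d = go p∣d (prime∣square p-prime c (∣m+n∣n⇒∣m {m = c * c} (subst (+ p ∣_) p≡ ∣-refl) (∣m⇒∣m*n d p∣d)))
      where
      f : ∀ s t p → t * p * (t * p) + s * p * (s * p) ≡ (t * t + s * s) * p * p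
      f = solve-∀
      go : + p ∣ d → ¬ + p ∣ c
      go (divides s e) (divides t e′) = prime∤1 p-prime (divides (t * t + s * s)
        (*-cancelʳ-≡ 1ℤ ((t * t + s * s) * + p) (+ p) {{π.p≢0}} (trans (*-identityˡ (+ p))
          (trans p≡ (trans (cong₂ (λ u v → u * u + v * v) e′ e) (f s t (+ p)))))))

    -- The real parts of z π̄ and z π multiply to x² p - d² norm z, so p divides one of them.
    ¬D⇒D̄ : ∀ z → + p ∣ norm z → ¬ D z → π̄.D z
    ¬D⇒D̄ z@(x , y) h ¬D = [ (λ Dz → contradiction Dz ¬D) , (λ h → h) ]′
      (euclid p-prime (dot c d z) (dot c (- d) z)
        (∣-combination (x * x) (- (d * d)) (subst (+ p ∣_) p≡ ∣-refl) h (f c d x y)))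
      where
      f : ∀ c d x y → (x * c + y * d) * (x * c + y * - d) ≡ x * x * (c * c + d * d) + - (d * d) * (x * x + y * y)
      f = solve-∀

    -- Modulo p only 2 d `cross c d z` remains, and p divides neither 2 nor d. Hence multiplication
    -- by π̄ neither creates nor destroys divisibility by π.
    dot-conj : ∀ z → dot c d (mul c (- d) z) ≡ proj₁ z * + p + + 2 * (d * cross c d z)
    dot-conj (s , t) = trans (f c d s t) (cong (λ u → s * u + + 2 * (d * (t * c - s * d))) (sym p≡))
      where
      f : ∀ c d s t → (s * c - t * - d) * c + (s * - d + t * c) * d ≡ s * (c * c + d * d) + + 2 * (d * (t * c - s * d))
      f = solve-∀

    D-conj⁺ : ∀ z → D z → D (mul c (- d) z)
    D-conj⁺ z h = subst (+ p ∣_) (sym (dot-conj z))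
      (∣m∣n⇒∣m+n (∣n⇒∣m*n (proj₁ z) ∣-refl) (∣n⇒∣m*n (+ 2) (∣n⇒∣m*n d (π.dot∣⇒cross∣ z h))))

    D-conj⁻ : ∀ z → D (mul c (- d) z) → D z
    D-conj⁻ z h = π.cross∣⇒dot∣ z
      ([ (λ p∣2 → contradiction p∣2 p∤2)
       , [ (λ p∣d → contradiction p∣d p∤d) , (λ e → e) ]′ ∘ euclid p-prime d (cross c d z)
       ]′ (euclid p-prime (+ 2) (d * cross c d z)
            (∣m+n∣m⇒∣n (subst (+ p ∣_) (dot-conj z) h) (∣n⇒∣m*n (proj₁ z) ∣-refl))))

    ∣norm : ∀ m z → R (p ℕ.* m) z → + p ∣ norm z
    ∣norm m z r = subst (+ p ∣_) (sym r) (∣-pos⁺ (ℕ.m∣m*n m))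

    count-D : ∀ {m k} → Count (R m) k → Count (λ z → R (p ℕ.* m) z × D z) k
    count-D {m} = count-bij (mul c d) π.mul-injective (λ z r → π.R-mul⁺ m z r , π.D-mul z)
      (λ z (r , h) → π.R-surjective m z r h)

    -- Elements of norm p m outside the multiples of π are multiples of π̄, and their quotients by
    -- π̄ again lie outside the multiples of π.
    count-¬D : ∀ {m k} → Count (λ z → R m z × ¬ D z) k → Count (λ z → R (p ℕ.* m) z × ¬ D z) k
    count-¬D {m} = count-bij (mul c (- d)) π̄.mul-injective
      (λ z (r , ¬h) → π̄.R-mul⁺ m z r , ¬h ∘ D-conj⁻ z) back
      where
      back : ∀ z → R (p ℕ.* m) z × ¬ D z → ∃ λ w → (R m w × ¬ D w) × z ≡ mul c (- d) w
      back z (r , ¬h) = let (w , r′ , e) = π̄.R-surjective m z r (¬D⇒D̄ z (∣norm m z r) ¬h) in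
        w , (r′ , λ h → ¬h (subst D (sym e) (D-conj⁺ w h))) , e

    count-¬D-^ : ∀ v {m k} → ¬ p ℕ.∣ m → Count (R m) k → Count (λ z → R (p ℕ.^ v ℕ.* m) z × ¬ D z) k
    count-¬D-^ zero {m} p∤m C rewrite ℕ.*-identityˡ m =
      count-cong (λ z r → r , λ h → p∤m (∣-pos⁻ (subst (+ p ∣_) r (π.D⇒∣norm z h)))) (λ _ → proj₁) C
    count-¬D-^ (suc v) {m} {k} p∤m C =
      subst (λ n → Count (λ z → R n z × ¬ D z) k) (sym (ℕ.*-assoc p (p ℕ.^ v) m)) (count-¬D (count-¬D-^ v p∤m C))

    -- One more power of p keeps the (1 + v) k elements counted so far, now as multiples of π, and
    -- adds the k elements not divisible by π.
    count-^ : ∀ v {m k} → ¬ p ℕ.∣ m → Count (R m) k → Count (R (p ℕ.^ v ℕ.* m)) ((1ℤ + + v) * k)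
    count-^ zero {m} {k} p∤m C rewrite ℕ.*-identityˡ m | *-identityˡ k = C
    count-^ (suc v) {m} {k} p∤m C = subst₂ (λ n → Count (R n)) (sym (ℕ.*-assoc p (p ℕ.^ v) m)) (f (+ v) k)
      (count-cong (λ _ → [ proj₁ , proj₁ ]′) split
        (count-⊎ (λ _ (_ , h) (_ , ¬h) → ¬h h) (count-D (count-^ v p∤m C)) (count-¬D (count-¬D-^ v p∤m C))))
      where
      f : ∀ v k → (1ℤ + v) * k + k ≡ (1ℤ + (1ℤ + v)) * k
      f = solve-∀
      n = p ℕ.* (p ℕ.^ v ℕ.* m)
      split : ∀ z → R n z → (R n z × D z) ⊎ (R n z × ¬ D z)
      split z r with + p ∣? dot c d z
      ... | yes h = inj₁ (r , h)
      ... | no ¬h = inj₂ (r , ¬h)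

  1mod4∤2 : ∀ {p} → p ℕ.% 4 ≡ 1 → Prime p → ¬ + p ∣ + 2
  1mod4∤2 {p} e pr p∣2 with prime⇒irreducible prime[2] (∣-pos⁻ p∣2)
  ... | inj₁ refl = ¬prime[1] pr
  ... | inj₂ refl = contradiction e λ ()

  count-split-^ : ∀ {p} → Prime p → p ℕ.% 4 ≡ 1 → ∀ v {m k} → ¬ p ℕ.∣ m → Count (R m) k →
    Count (R (p ℕ.^ v ℕ.* m)) ((1ℤ + + v) * k)
  count-split-^ {p} pr e with c , d , p≡ ← Zagier.sum-of-squares p pr e =
    Split.count-^ p pr (1mod4∤2 e pr) (+ c) (+ d)
      (trans (cong +_ p≡) (trans (pos-+ (c ℕ.* c) (d ℕ.* d)) (cong₂ _+_ (pos-* c c) (pos-* d d))))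

  -- The factor (1 + (-1)^w)/2, by recursion in steps of two to follow the removal of q².
  evenness : ℕ → ℤ
  evenness zero          = 1ℤ
  evenness (suc zero)    = + 0
  evenness (suc (suc w)) = evenness w

  -- Inert primes q ≡ 3 (mod 4).

  module Inert (q : ℕ) (q-prime : Prime q) (q%4≡3 : q ℕ.% 4 ≡ 3) where

    open NonResidue q q-prime q%4≡3 using (∣-sum-of-squares)

    instance
      q≢0 : NonZero (+ q)
      q≢0 = prime⇒nonZero q-prime

    scale : ℤ × ℤ → ℤ × ℤ
    scale (x , y) = x * + q , y * + q

    ∣norm⇒scale : ∀ z → + q ∣ norm z → ∃ λ w → z ≡ scale w
    ∣norm⇒scale (x , y) h =
      let divides s e  = ∣-sum-of-squares x y h
          divides t e′ = ∣-sum-of-squares y x (subst (+ q ∣_) (+-comm (x * x) (y * y)) h)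
      in (s , t) , cong₂ _,_ e e′

    scale-injective : ∀ {z w} → scale z ≡ scale w → z ≡ w
    scale-injective {x , y} {x′ , y′} eq =
      cong₂ _,_ (*-cancelʳ-≡ x x′ (+ q) (cong proj₁ eq)) (*-cancelʳ-≡ y y′ (+ q) (cong proj₂ eq))

    norm-scale : ∀ z → norm (scale z) ≡ norm z * + (q ℕ.* q)
    norm-scale (x , y) = trans (f x y (+ q)) (cong ((x * x + y * y) *_) (sym (pos-* q q)))
      where
      f : ∀ x y q → x * q * (x * q) + y * q * (y * q) ≡ (x * x + y * y) * (q * q)
      f = solve-∀

    R-scale⇒∣ : ∀ n z → R n (scale z) → q ℕ.* q ℕ.∣ n
    R-scale⇒∣ n z r = ∣-pos⁻ (divides (norm z) (trans (sym r) (norm-scale z)))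

    ∣R⇒scale : ∀ n z → q ℕ.∣ n → R n z → ∃ λ w → z ≡ scale w
    ∣R⇒scale n z h r = ∣norm⇒scale z (subst (+ q ∣_) (sym r) (∣-pos⁺ h))

    count-q² : ∀ {m k} → Count (R m) k → Count (R (q ℕ.* q ℕ.* m)) k
    count-q² {m} = count-bij scale scale-injective
      (λ z r → trans (norm-scale z) (trans (cong (_* + (q ℕ.* q)) r) (trans (*-comm (+ m) _) (sym (pos-* (q ℕ.* q) m)))))
      back
      where
      instance _ = ℕ.m*n≢0 q q
      back : ∀ z → R (q ℕ.* q ℕ.* m) z → ∃ λ w → R m w × z ≡ scale w
      back z r = let (w , e) = ∣R⇒scale _ z (ℕ.∣-trans (ℕ.m∣m*n q) (ℕ.m∣m*n m)) r in
        w , *-cancelʳ-≡ (norm w) (+ m) (+ (q ℕ.* q)) (trans (sym (norm-scale w)) (trans (cong norm (sym e))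
          (trans r (trans (pos-* (q ℕ.* q) m) (*-comm _ (+ m)))))) , e

    -- Exponents drop by two through division by q. At exponent 1 nothing remains: an element of
    -- norm q m would be q times another, giving q² ∣ q m and so q ∣ m.
    count-^ : ∀ w {m k} → ¬ q ℕ.∣ m → Count (R m) k → Count (R (q ℕ.^ w ℕ.* m)) (evenness w * k)
    count-^ zero {m} {k} q∤m C rewrite ℕ.*-identityˡ m | *-identityˡ k = C
    count-^ (suc zero) {m} {k} q∤m C rewrite ℕ.*-identityʳ q = count-∅ empty
      where
      empty : ∀ z → ¬ R (q ℕ.* m) z
      empty z r = let (w , e) = ∣R⇒scale _ z (ℕ.m∣m*n m) r in
        q∤m (ℕ.*-cancelˡ-∣ q (R-scale⇒∣ _ w (subst (R (q ℕ.* m)) e r)))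
    count-^ (suc (suc w)) {m} {k} q∤m C = subst (λ n → Count (R n) (evenness w * k)) (f q (q ℕ.^ w) m) (count-q² (count-^ w q∤m C))
      where
      f : ∀ q a m → q ℕ.* q ℕ.* (a ℕ.* m) ≡ q ℕ.* (q ℕ.* a) ℕ.* m
      f = ℕ-solve-∀

-- The number of representations of n as a sum of two squares.

module TwoSquareCount where

  open import Data.Nat as ℕ using (ℕ; zero; suc)
  import Data.Nat.Properties as ℕ
  import Data.Nat.Divisibility as ℕ
  open import Data.Integer as ℤ using (ℤ; +_; -[1+_]; -_; _+_; _*_; 1ℤ; 0ℤ)
  open import Data.Integer.Properties
  open import Data.Integer.DivMod as ℤD using ()
  open import Data.Integer.Tactic.RingSolver using (solve-∀)
  open import Data.Nat.Tactic.RingSolver using () renaming (solve-∀ to ℕ-solve-∀)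
  open Counting
  open GaussianNorm

  prime[3] : Prime 3
  prime[3] = from-yes (prime? 3)

  square-abs : ∀ x → x * x ≡ + (ℤ.∣ x ∣ ℕ.* ℤ.∣ x ∣)
  square-abs (+ n)    = sym (pos-* n n)
  square-abs -[1+ n ] = refl

  units : List (ℤ × ℤ)
  units = (1ℤ , 0ℤ) ∷ (- 1ℤ , 0ℤ) ∷ (0ℤ , 1ℤ) ∷ (0ℤ , - 1ℤ) ∷ []

  sum-of-squares≡1 : ∀ u v → u ℕ.* u ℕ.+ v ℕ.* v ≡ 1 → (u ≡ 1 × v ≡ 0) ⊎ (u ≡ 0 × v ≡ 1)
  sum-of-squares≡1 0 v e = inj₂ (refl , ℕ.m*n≡1⇒m≡1 v v e)
  sum-of-squares≡1 1 zero e = inj₁ (refl , refl)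
  sum-of-squares≡1 (suc (suc u)) v ()

  ∈-units : ∀ x y → (ℤ.∣ x ∣ ≡ 1 × ℤ.∣ y ∣ ≡ 0) ⊎ (ℤ.∣ x ∣ ≡ 0 × ℤ.∣ y ∣ ≡ 1) → (x , y) ∈ units
  ∈-units (+ 1)    (+ 0)    (inj₁ (refl , refl)) = here refl
  ∈-units -[1+ 0 ] (+ 0)    (inj₁ (refl , refl)) = there (here refl)
  ∈-units (+ 0)    (+ 1)    (inj₂ (refl , refl)) = there (there (here refl))
  ∈-units (+ 0)    -[1+ 0 ] (inj₂ (refl , refl)) = there (there (there (here refl)))

  count-R1 : Count (R 1) (+ 4)
  count-R1 = units ,
    ((λ ()) ∷ (λ ()) ∷ (λ ()) ∷ []) ∷ ((λ ()) ∷ (λ ()) ∷ []) ∷ ((λ ()) ∷ []) ∷ [] ∷ [] ,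
    (λ z → mk⇔ (⇒ z) (⇐ z)) , refl
    where
    ⇒ : ∀ z → z ∈ units → R 1 z
    ⇒ _ (here refl) = refl
    ⇒ _ (there (here refl)) = refl
    ⇒ _ (there (there (here refl))) = refl
    ⇒ _ (there (there (there (here refl)))) = refl
    ⇐ : ∀ z → R 1 z → z ∈ units
    ⇐ (x , y) r = ∈-units x y (sum-of-squares≡1 ℤ.∣ x ∣ ℤ.∣ y ∣
      (+-injective (trans (pos-+ (ℤ.∣ x ∣ ℕ.* ℤ.∣ x ∣) _) (trans (sym (cong₂ _+_ (square-abs x) (square-abs y))) r))))

  prime∣prime⇒≡ : ∀ {p q} → Prime p → Prime q → p ℕ.∣ q → p ≡ q
  prime∣prime⇒≡ pr pr′ p∣q with prime⇒irreducible pr′ p∣q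
  ... | inj₁ refl = contradiction pr ¬prime[1]
  ... | inj₂ p≡q  = p≡q

  prime∣^ : ∀ {p} → Prime p → ∀ q v → p ℕ.∣ q ℕ.^ v → p ℕ.∣ q
  prime∣^ pr q zero h with refl ← ℕ.∣1⇒≡1 h = contradiction pr ¬prime[1]
  prime∣^ pr q (suc v) h = [ id , prime∣^ pr q v ]′ (euclidsLemma q (q ℕ.^ v) pr h)

  factors : List (ℕ × ℕ) → ℕ
  factors l = prodℕ (map primePow l)

  -- Combined with distinctness of the listed primes, this makes each prime coprime to the product
  -- of the later powers.
  prime∣factors : ∀ {p} → Prime p → ∀ l → All (Prime ∘ proj₁) l → p ℕ.∣ factors l → p ∈ map proj₁ l
  prime∣factors pr [] _ h with refl ← ℕ.∣1⇒≡1 h = contradiction pr ¬prime[1]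
  prime∣factors pr ((q , v) ∷ l) (pr′ ∷ prs) h =
    [ (λ h → here (prime∣prime⇒≡ pr pr′ (prime∣^ pr q v h))) , there ∘ prime∣factors pr l prs ]′
      (euclidsLemma (q ℕ.^ v) (factors l) pr h)

  ΠP ΠQ : List (ℕ × ℕ) → ℤ
  ΠP ps = prodℤ (map (λ pv → 1ℤ + + proj₂ pv) ps)
  ΠQ qs = prodℤ (map (λ qw → (1ℤ + sgn (proj₂ qw)) ℤD./ + 2) qs)

  sgn-2+ : ∀ w → sgn (suc (suc w)) ≡ sgn w
  sgn-2+ w = f (sgn w)
    where
    f : ∀ s → - 1ℤ * (- 1ℤ * s) ≡ s
    f = solve-∀

  evenness≡ : ∀ w → evenness w ≡ (1ℤ + sgn w) ℤD./ + 2
  evenness≡ zero          = refl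
  evenness≡ (suc zero)    = refl
  evenness≡ (suc (suc w)) = trans (evenness≡ w) (cong (λ s → (1ℤ + s) ℤD./ + 2) (sym (sgn-2+ w)))

  count-ps : ∀ ps → All ValidP ps → Unique (map proj₁ ps) → Count (R (factors ps)) (ΠP ps * + 4)
  count-ps [] _ _ = count-R1
  count-ps ((p , v) ∷ ps) ((pr , e , _) ∷ vs) u@(_ ∷ us) =
    subst (Count _) (sym (*-assoc (1ℤ + + v) (ΠP ps) (+ 4)))
      (count-split-^ pr e v (Unique[x∷xs]⇒x∉xs u ∘ prime∣factors pr ps (All.map proj₁ vs)) (count-ps ps vs us))

  count-qs : ∀ {m k} qs → (∀ q → Prime q → q ℕ.% 4 ≡ 3 → ¬ q ℕ.∣ m) → All ValidQ qs → Unique (map proj₁ qs) →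
    Count (R m) k → Count (R (factors qs ℕ.* m)) (ΠQ qs * k)
  count-qs {m} {k} [] _ _ _ C = subst₂ (λ n → Count (R n)) (sym (ℕ.*-identityˡ m)) (sym (*-identityˡ k)) C
  count-qs {m} {k} ((q , w) ∷ qs) q∤m ((pr , e , _) ∷ vs) u@(_ ∷ us) C =
    subst₂ (λ n → Count (R n)) (sym (ℕ.*-assoc (q ℕ.^ w) (factors qs) m))
      (trans (cong (_* (ΠQ qs * k)) (evenness≡ w)) (sym (*-assoc ((1ℤ + sgn w) ℤD./ + 2) (ΠQ qs) k)))
      (Inert.count-^ q pr e w q∤ (count-qs qs q∤m vs us C))
    where
    q∤ : ¬ q ℕ.∣ factors qs ℕ.* m
    q∤ h = [ Unique[x∷xs]⇒x∉xs u ∘ prime∣factors pr qs (All.map proj₁ vs) , q∤m q pr e ]′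
      (euclidsLemma (factors qs) m pr h)

  ¬inert-∣-ps : ∀ ps → All ValidP ps → ∀ q → Prime q → q ℕ.% 4 ≡ 3 → ¬ q ℕ.∣ factors ps
  ¬inert-∣-ps ps vs q pr e h with ∈-map⁻ proj₁ (prime∣factors pr ps (All.map proj₁ vs) h)
  ... | _ , x∈ , refl with _ , e′ , _ ← All.lookup vs x∈ = contradiction (trans (sym e) e′) λ ()

  3∤qs : ∀ qs → All ValidQ qs → ¬ 3 ℕ.∣ factors qs
  3∤qs qs vs h with ∈-map⁻ proj₁ (prime∣factors prime[3] qs (All.map proj₁ vs) h)
  ... | _ , x∈ , refl with _ , _ , 3<3 , _ ← All.lookup vs x∈ = contradiction 3<3 (ℕ.<-irrefl refl)

  -- The prime 3 is inert too and contributes `evenness b`; the condition 3 < q keeps it out of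
  -- `qs`, so it does not divide the rest.
  count-total : ∀ a b ps qs → All ValidP ps → Unique (map proj₁ ps) → All ValidQ qs → Unique (map proj₁ qs) →
    Count (R (2 ℕ.^ a ℕ.* 3 ℕ.^ b ℕ.* factors ps ℕ.* factors qs)) (evenness b * (+ 4 * Λ ps qs))
  count-total a b ps qs vp up vq uq =
    subst₂ (λ n → Count (R n)) (f (2 ℕ.^ a) (3 ℕ.^ b) (factors ps) (factors qs)) (cong (evenness b *_) (g (ΠP ps) (ΠQ qs)))
      (count-2^ a (Inert.count-^ 3 prime[3] refl b 3∤
        (count-qs qs (¬inert-∣-ps ps vp) vq uq (count-ps ps vp up))))
    where
    f : ∀ a b p q → a ℕ.* (b ℕ.* (q ℕ.* p)) ≡ a ℕ.* b ℕ.* p ℕ.* q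
    f = ℕ-solve-∀
    g : ∀ p q → q * (p * + 4) ≡ + 4 * (p * q)
    g = solve-∀
    3∤ : ¬ 3 ℕ.∣ factors qs ℕ.* factors ps
    3∤ h = [ 3∤qs qs vq , ¬inert-∣-ps ps vp 3 prime[3] refl ]′ (euclidsLemma (factors qs) (factors ps) prime[3] h)

-- The residue of n modulo 3.

module CharacterModThree where

  open import Data.Nat as ℕ using (ℕ; zero; suc; s≤s)
  import Data.Nat.Properties as ℕ
  import Data.Nat.Divisibility as ℕ
  open import Data.Nat.DivMod using (m%n<n; %-distribˡ-*; m∣n⇒o%n%m≡o%m)
  open import Data.Integer as ℤ using (ℤ; +_; -_; _+_; _*_; 1ℤ; 0ℤ)
  open import Data.Integer.Properties
  open import Data.Integer.DivMod as ℤD using ()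
  open import Data.Integer.Tactic.RingSolver using (solve-∀)
  open GaussianNorm using (evenness)
  open TwoSquareCount

  -- Values of the nonprincipal Dirichlet character modulo 3.
  χ-residue : ℕ → ℤ
  χ-residue 1 = 1ℤ
  χ-residue 2 = - 1ℤ
  χ-residue _ = 0ℤ

  χ : ℕ → ℤ
  χ n = χ-residue (n ℕ.% 3)

  χ-residue-* : ∀ r s → r ℕ.< 3 → s ℕ.< 3 → χ-residue ((r ℕ.* s) ℕ.% 3) ≡ χ-residue r * χ-residue s
  χ-residue-* 0 s _ _ = refl
  χ-residue-* 1 0 _ _ = refl
  χ-residue-* 1 1 _ _ = refl
  χ-residue-* 1 2 _ _ = refl
  χ-residue-* 2 0 _ _ = refl
  χ-residue-* 2 1 _ _ = refl
  χ-residue-* 2 2 _ _ = refl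
  χ-residue-* (suc (suc (suc _))) _ (s≤s (s≤s (s≤s ()))) _
  χ-residue-* 1 (suc (suc (suc _))) _ (s≤s (s≤s (s≤s ())))
  χ-residue-* 2 (suc (suc (suc _))) _ (s≤s (s≤s (s≤s ())))

  χ-* : ∀ m n → χ (m ℕ.* n) ≡ χ m * χ n
  χ-* m n = trans (cong χ-residue (%-distribˡ-* m n 3)) (χ-residue-* (m ℕ.% 3) (n ℕ.% 3) (m%n<n m 3) (m%n<n n 3))

  χ-^ : ∀ m v → χ (m ℕ.^ v) ≡ χ m ℤ.^ v
  χ-^ m zero    = refl
  χ-^ m (suc v) = trans (χ-* m (m ℕ.^ v)) (cong (χ m *_) (χ-^ m v))

  sgn-+ : ∀ m n → sgn (m ℕ.+ n) ≡ sgn m * sgn n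
  sgn-+ m n = ^-distribˡ-+-* (- 1ℤ) m n

  χ-3∤ : ∀ n → ¬ 3 ℕ.∣ n → χ n ≡ 1ℤ ⊎ χ n ≡ - 1ℤ
  χ-3∤ n 3∤n = cases (n ℕ.% 3) refl (m%n<n n 3)
    where
    cases : ∀ r → n ℕ.% 3 ≡ r → r ℕ.< 3 → χ n ≡ 1ℤ ⊎ χ n ≡ - 1ℤ
    cases 0 e _ = contradiction (ℕ.m%n≡0⇒n∣m n 3 e) 3∤n
    cases 1 e _ = inj₁ (cong χ-residue e)
    cases 2 e _ = inj₂ (cong χ-residue e)
    cases (suc (suc (suc _))) _ (s≤s (s≤s (s≤s ())))

  ≡5? : Decidable (λ (pv : ℕ × ℕ) → proj₁ pv ℕ.% 12 ≡ 5)
  ≡5? pv = proj₁ pv ℕ.% 12 ℕ.≟ 5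

  -- Modulo 12 a prime p ≡ 1 (mod 4) is 1 or 5, as 9 would make it divisible by 3. So χ p = -1
  -- exactly for the primes that `tCount` counts.
  χ-ps : ∀ ps → All ValidP ps → χ (factors ps) ≡ sgn (tCount ps)
  χ-ps [] _ = refl
  χ-ps ((p , v) ∷ ps) ((pr , p%4≡1 , _) ∷ vs) with p ℕ.% 12 ℕ.≟ 5
  ... | yes e = trans (χ-* (p ℕ.^ v) (factors ps))
    (trans (cong₂ _*_ (trans (χ-^ p v) (cong (ℤ._^ v) χp)) (χ-ps ps vs)) (trans (sym (sgn-+ v (tCount ps)))
      (cong (λ l → sgn (sumℕ (map proj₂ l))) (sym (filter-accept ≡5? {p , v} {ps} e)))))
    where
    χp : χ p ≡ - 1ℤ
    χp = cong χ-residue (trans (sym (m∣n⇒o%n%m≡o%m 3 12 p (ℕ.divides 4 refl))) (cong (ℕ._% 3) e))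
  ... | no ne = trans (χ-* (p ℕ.^ v) (factors ps))
    (trans (cong₂ _*_ (trans (χ-^ p v) (trans (cong (ℤ._^ v) χp) (^-zeroˡ v))) (χ-ps ps vs)) (trans (*-identityˡ _)
      (cong (λ l → sgn (sumℕ (map proj₂ l))) (sym (filter-reject ≡5? {p , v} {ps} ne)))))
    where
    3∤p : ¬ 3 ℕ.∣ p
    3∤p h with refl ← prime∣prime⇒≡ prime[3] pr h = contradiction p%4≡1 λ ()
    χ≢-1 : ∀ r → r ℕ.< 12 → r ℕ.% 4 ≡ 1 → r ≢ 5 → χ r ≢ - 1ℤ
    χ≢-1 1 _ _ _ ()
    χ≢-1 5 _ _ n _ = n refl
    χ≢-1 9 _ _ _ ()
    χ≢-1 (suc (suc (suc (suc (suc (suc (suc (suc (suc (suc (suc (suc r)))))))))))) lt _ _ _ = ℕ.m+n≮m 12 r lt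
    χp : χ p ≡ 1ℤ
    χp = [ id , (λ e → contradiction
      (trans (cong χ-residue (m∣n⇒o%n%m≡o%m 3 12 p (ℕ.divides 4 refl))) e)
      (χ≢-1 (p ℕ.% 12) (m%n<n p 12) (trans (m∣n⇒o%n%m≡o%m 4 12 p (ℕ.divides 3 refl)) p%4≡1) ne)) ]′ (χ-3∤ p 3∤p)

  -- For even w the power is a square, with χ = 1; for odd w both sides vanish.
  χ-evenness : ∀ q w → χ q * χ q ≡ 1ℤ → χ (q ℕ.^ w) * evenness w ≡ evenness w
  χ-evenness q zero          _ = refl
  χ-evenness q (suc zero)    _ = *-zeroʳ (χ (q ℕ.^ 1))
  χ-evenness q (suc (suc w)) e = trans (cong (_* evenness w) χ-suc²) (χ-evenness q w e)
    where
    χ-suc² : χ (q ℕ.^ suc (suc w)) ≡ χ (q ℕ.^ w)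
    χ-suc² = trans (χ-* q _) (trans (cong (χ q *_) (χ-* q (q ℕ.^ w)))
      (trans (sym (*-assoc (χ q) (χ q) _)) (trans (cong (_* χ (q ℕ.^ w)) e) (*-identityˡ _))))

  χ-qs : ∀ qs → All ValidQ qs → χ (factors qs) * ΠQ qs ≡ ΠQ qs
  χ-qs [] _ = refl
  χ-qs ((q , w) ∷ qs) ((pr , _ , 3<q , _) ∷ vs) =
    trans (cong (_* (half * ΠQ qs)) (χ-* (q ℕ.^ w) (factors qs)))
      (trans (f (χ (q ℕ.^ w)) (χ (factors qs)) half (ΠQ qs))
        (cong₂ _*_ (subst (λ h → χ (q ℕ.^ w) * h ≡ h) (evenness≡ w) (χ-evenness q w χ²)) (χ-qs qs vs)))
    where
    half = (1ℤ + sgn w) ℤD./ + 2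
    f : ∀ a b c d → a * b * (c * d) ≡ a * c * (b * d)
    f = solve-∀
    3∤q : ¬ 3 ℕ.∣ q
    3∤q h = ℕ.<⇒≢ 3<q (prime∣prime⇒≡ prime[3] pr h)
    χ² : χ q * χ q ≡ 1ℤ
    χ² = [ (λ e → cong (λ u → u * u) e) , (λ e → cong (λ u → u * u) e) ]′ (χ-3∤ q 3∤q)

  -- Since χ 2 = -1, the power of 2 gives (-1)^a, and the p's give (-1)^t. The q's may have χ = -1
  -- only when some exponent is odd, and then Λ is 0.
  χ-Λ : ∀ a ps qs → All ValidP ps → All ValidQ qs →
    χ (2 ℕ.^ a ℕ.* factors ps ℕ.* factors qs) * Λ ps qs ≡ sgn (a ℕ.+ tCount ps) * Λ ps qs
  χ-Λ a ps qs vp vq = begin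
    χ (2 ℕ.^ a ℕ.* factors ps ℕ.* factors qs) * (ΠP ps * ΠQ qs)
      ≡⟨ cong (_* (ΠP ps * ΠQ qs)) (trans (χ-* (2 ℕ.^ a ℕ.* factors ps) (factors qs))
           (cong (_* χ (factors qs)) (trans (χ-* (2 ℕ.^ a) (factors ps)) (cong₂ _*_ (χ-^ 2 a) (χ-ps ps vp))))) ⟩
    sgn a * sgn (tCount ps) * χ (factors qs) * (ΠP ps * ΠQ qs)
      ≡⟨ f (sgn a * sgn (tCount ps)) (χ (factors qs)) (ΠP ps) (ΠQ qs) ⟩
    sgn a * sgn (tCount ps) * (ΠP ps * (χ (factors qs) * ΠQ qs))
      ≡⟨ cong₂ (λ s q → s * (ΠP ps * q)) (sym (sgn-+ a (tCount ps))) (χ-qs qs vq) ⟩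
    sgn (a ℕ.+ tCount ps) * (ΠP ps * ΠQ qs) ∎
    where
    open ≡-Reasoning
    f : ∀ s x p q → s * x * (p * q) ≡ s * (p * (x * q))
    f = solve-∀

-- Congruence conditions modulo 3 on the elements of norm n.

module QuadraticForms where

  open import Data.Nat as ℕ using (zero; suc; s≤s)
  import Data.Nat.Properties as ℕ
  import Data.Nat.Divisibility as ℕ
  open import Data.Nat.DivMod using (m≡m%n+[m/n]*n; [m+n]%n≡m%n; m%n<n)
  open import Data.Integer using (ℤ; +_; -_; _+_; _*_; _-_; 1ℤ; 0ℤ)
  open import Data.Integer.Properties
  open import Data.Integer.DivMod using (_%ℕ_; _/ℕ_; n%ℕd<d; a≡a%ℕn+[a/ℕn]*n)
  open import Data.Integer.Divisibility.Signed
  open import Data.Integer.Tactic.RingSolver using (solve-∀)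
  open Counting
  open IntegerDivisibility
  open MinusOneNonResidue using (module NonResidue)
  open GaussianNorm
  open TwoSquareCount
  open CharacterModThree

  3∣y 3∣y-x 3∣x 3∣y+x : ℤ × ℤ → Set
  3∣y   (x , y) = + 3 ∣ y
  3∣x   (x , y) = + 3 ∣ x
  3∣y-x (x , y) = + 3 ∣ y - x
  3∣y+x (x , y) = + 3 ∣ y + x

  3∤1 : ¬ + 3 ∣ 1ℤ
  3∤1 = from-no (+ 3 ∣? 1ℤ)

  3∤2 : ¬ + 3 ∣ + 2
  3∤2 = from-no (+ 3 ∣? + 2)

  residue₃ : ∀ u → + 3 ∣ u ⊎ + 3 ∣ u * u - 1ℤ
  residue₃ u = cases (u %ℕ 3) (n%ℕd<d u 3) (a≡a%ℕn+[a/ℕn]*n u 3)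
    where
    k = u /ℕ 3
    f₀ : ∀ k → 0ℤ + k * + 3 ≡ k * + 3
    f₀ = solve-∀
    f₁ : ∀ k → (1ℤ + k * + 3) * (1ℤ + k * + 3) - 1ℤ ≡ (k * k * + 3 + + 2 * k) * + 3
    f₁ = solve-∀
    f₂ : ∀ k → (+ 2 + k * + 3) * (+ 2 + k * + 3) - 1ℤ ≡ (k * k * + 3 + + 4 * k + 1ℤ) * + 3
    f₂ = solve-∀
    cases : ∀ r → r ℕ.< 3 → u ≡ + r + k * + 3 → + 3 ∣ u ⊎ + 3 ∣ u * u - 1ℤ
    cases 0 _ e = inj₁ (divides k (trans e (f₀ k)))
    cases 1 _ e = inj₂ (divides (k * k * + 3 + + 2 * k) (trans (cong (λ u → u * u - 1ℤ) e) (f₁ k)))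
    cases 2 _ e = inj₂ (divides (k * k * + 3 + + 4 * k + 1ℤ) (trans (cong (λ u → u * u - 1ℤ) e) (f₂ k)))
    cases (suc (suc (suc _))) (s≤s (s≤s (s≤s ()))) _

  module Norm≡1 where

    disjoint : ∀ z → + 3 ∣ norm z - 1ℤ → 3∣y z → ¬ 3∣x z
    disjoint (x , y) h hy hx = 3∤1 (subst (+ 3 ∣_) (f x y) (∣m∣n⇒∣m-n (∣m∣n⇒∣m+n (∣n⇒∣m*n x hx) (∣n⇒∣m*n y hy)) h))
      where
      f : ∀ x y → x * x + y * y - (x * x + y * y - 1ℤ) ≡ 1ℤ
      f = solve-∀

    -- If 3 divided neither coordinate, both squares would be 1 and the norm 2 modulo 3.
    cover : ∀ z → + 3 ∣ norm z - 1ℤ → 3∣y z ⊎ 3∣x z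
    cover (x , y) h = cases (residue₃ x) (residue₃ y)
      where
      f : ∀ x y → x * x + y * y - 1ℤ - (x * x - 1ℤ + (y * y - 1ℤ)) ≡ 1ℤ
      f = solve-∀
      cases : _ → _ → 3∣y (x , y) ⊎ 3∣x (x , y)
      cases (inj₁ hx) _         = inj₂ hx
      cases (inj₂ _)  (inj₁ hy) = inj₁ hy
      cases (inj₂ hx) (inj₂ hy) = contradiction (subst (+ 3 ∣_) (f x y) (∣m∣n⇒∣m-n h (∣m∣n⇒∣m+n hx hy))) 3∤1

    -- If y ≡ x modulo 3, the norm is 2x², hence 0 or 2.
    ¬3∣y-x : ∀ z → + 3 ∣ norm z - 1ℤ → ¬ 3∣y-x z
    ¬3∣y-x (x , y) h h′ = cases (residue₃ x)
      where
      f : ∀ x y → 1ℤ ≡ + 2 * x * x + 1ℤ * ((y + x) * (y - x) - (x * x + y * y - 1ℤ))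
      f = solve-∀
      g : ∀ x y → 1ℤ ≡ - + 2 * (x * x - 1ℤ) + 1ℤ * (x * x + y * y - 1ℤ - (y + x) * (y - x))
      g = solve-∀
      cases : _ → _
      cases (inj₁ hx) = 3∤1 (∣-combination (+ 2 * x) 1ℤ hx (∣m∣n⇒∣m-n (∣n⇒∣m*n (y + x) h′) h) (f x y))
      cases (inj₂ hx) = 3∤1 (∣-combination (- + 2) 1ℤ hx (∣m∣n⇒∣m-n h (∣n⇒∣m*n (y + x) h′)) (g x y))

  module Norm≡2 where

    -- The norm would be x² modulo 3, and -1 is not a square.
    ¬3∣y : ∀ z → + 3 ∣ norm z + 1ℤ → ¬ 3∣y z
    ¬3∣y (x , y) h hy = cases (residue₃ x)
      where
      f : ∀ x y → x * x + y * y + 1ℤ - (x * x + y * y) ≡ 1ℤ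
      f = solve-∀
      g : ∀ x y → x * x + y * y + 1ℤ - (x * x - 1ℤ + y * y) ≡ + 2
      g = solve-∀
      cases : _ → _
      cases (inj₁ hx) = 3∤1 (subst (+ 3 ∣_) (f x y) (∣m∣n⇒∣m-n h (∣m∣n⇒∣m+n (∣n⇒∣m*n x hx) (∣n⇒∣m*n y hy))))
      cases (inj₂ hx) = 3∤2 (subst (+ 3 ∣_) (g x y) (∣m∣n⇒∣m-n h (∣m∣n⇒∣m+n hx (∣n⇒∣m*n y hy))))

    ¬3∣x : ∀ z → + 3 ∣ norm z + 1ℤ → ¬ 3∣x z
    ¬3∣x (x , y) h = ¬3∣y (y , x) (subst (λ n → + 3 ∣ n + 1ℤ) (+-comm (x * x) (y * y)) h)

    -- Neither coordinate is divisible by 3, so both squares are 1 and 3 ∣ (y - x)(y + x).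
    cover : ∀ z → + 3 ∣ norm z + 1ℤ → 3∣y-x z ⊎ 3∣y+x z
    cover (x , y) h = cases (residue₃ x) (residue₃ y)
      where
      f : ∀ x y → y * y - 1ℤ - (x * x - 1ℤ) ≡ (y - x) * (y + x)
      f = solve-∀
      cases : _ → _ → 3∣y-x (x , y) ⊎ 3∣y+x (x , y)
      cases (inj₁ hx) _         = contradiction hx (¬3∣x (x , y) h)
      cases (inj₂ _)  (inj₁ hy) = contradiction hy (¬3∣y (x , y) h)
      cases (inj₂ hx) (inj₂ hy) = euclid prime[3] (y - x) (y + x) (subst (+ 3 ∣_) (f x y) (∣m∣n⇒∣m-n hy hx))

    disjoint : ∀ z → + 3 ∣ norm z + 1ℤ → 3∣y-x z → ¬ 3∣y+x z
    disjoint z@(x , y) h h₁ h₂ = [ 3∤2 , ¬3∣y z h ]′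
      (euclid prime[3] (+ 2) y (subst (+ 3 ∣_) (f x y) (∣m∣n⇒∣m+n h₁ h₂)))
      where
      f : ∀ x y → y - x + (y + x) ≡ + 2 * y
      f = solve-∀

  R-mod : ∀ {n} r z → n ℕ.% 3 ≡ r → R n z → + 3 ∣ norm z - + r
  R-mod {n} r z e nz = divides (+ (n ℕ./ 3)) (trans (cong (λ u → u - + r) (trans nz n≡)) (f (+ r) (+ (n ℕ./ 3))))
    where
    n≡ : + n ≡ + r + + (n ℕ./ 3) * + 3
    n≡ = trans (cong +_ (trans (m≡m%n+[m/n]*n n 3) (cong (ℕ._+ n ℕ./ 3 ℕ.* 3) e)))
      (trans (pos-+ r _) (cong (λ u → + r + u) (pos-* (n ℕ./ 3) 3)))
    f : ∀ r k → r + k * + 3 - r ≡ k * + 3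
    f = solve-∀

  -- The involution exchanges the two parts, so both have the same size l, unknown at first; their
  -- disjoint union gives l + l = 4k.
  count-half : ∀ {P Q Q′ : ℤ × ℤ → Set} {k} (f : ℤ × ℤ → ℤ × ℤ) → (∀ z → f (f z) ≡ z) →
    (∀ z → P z → P (f z)) → (∀ z → Q z → Q′ (f z)) → (∀ z → Q′ z → Q (f z)) →
    Decidable Q → (∀ z → P z → Q z → ¬ Q′ z) → (∀ z → P z → Q z ⊎ Q′ z) →
    Count P (+ 4 * k) → Count (λ z → P z × Q z) (+ 2 * k)
  count-half {P} {Q} {Q′} {k} f ff fP fQ fQ′ Q? disjoint cover C =
    subst (Count _) (*-cancelˡ-≡ (+ 2) l (+ 2 * k) (trans (g l) (trans 2l≡4k (h k)))) CQ
    where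
    l = proj₁ (count-filter Q? C)
    CQ : Count (λ z → P z × Q z) l
    CQ = proj₂ (count-filter Q? C)
    CQ′ : Count (λ z → P z × Q′ z) l
    CQ′ = count-bij f (λ {z} {w} e → trans (sym (ff z)) (trans (cong f e) (ff w)))
      (λ z (p , q) → fP z p , fQ z q) (λ z (p , q) → f z , (fP z p , fQ′ z q) , sym (ff z)) CQ
    2l≡4k : l + l ≡ + 4 * k
    2l≡4k = count-unique
      (count-cong (λ _ → [ proj₁ , proj₁ ]′) (λ z p → [ (λ q → inj₁ (p , q)) , (λ q → inj₂ (p , q)) ]′ (cover z p))
        (count-⊎ (λ z (p , q) (_ , q′) → disjoint z p q q′) CQ CQ′)) C
    g : ∀ l → + 2 * l ≡ l + l
    g = solve-∀
    h : ∀ k → + 4 * k ≡ + 2 * (+ 2 * k)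
    h = solve-∀

  count-3∤ : ∀ {n k} → ¬ 3 ℕ.∣ n → Count (R n) (+ 4 * k) →
    Count (λ z → R n z × 3∣y z) ((1ℤ + χ n) * k) × Count (λ z → R n z × 3∣y-x z) ((1ℤ - χ n) * k)
  count-3∤ {n} {k} 3∤n C = cases (n ℕ.% 3) refl (m%n<n n 3)
    where
    -- Abstracting the value of χ n lets each residue case substitute it, after which the sizes
    -- compute to 2k and 0.
    Goal : ℤ → Set
    Goal s = Count (λ z → R n z × 3∣y z) ((1ℤ + s) * k) × Count (λ z → R n z × 3∣y-x z) ((1ℤ - s) * k)
    R-swap : ∀ z → R n z → R n (swap z)
    R-swap (x , y) = trans (+-comm (y * y) (x * x))
    neg : ℤ × ℤ → ℤ × ℤ
    neg (x , y) = - x , y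
    R-neg : ∀ z → R n z → R n (neg z)
    R-neg (x , y) = trans (f x y)
      where
      f : ∀ x y → - x * - x + y * y ≡ x * x + y * y
      f = solve-∀
    to-+ : ∀ z → 3∣y-x z → 3∣y+x (neg z)
    -- By definition y - x is y + (-x).
    to-+ _ h = h
    to-- : ∀ z → 3∣y+x z → 3∣y-x (neg z)
    to-- (x , y) = subst (λ u → + 3 ∣ y + u) (sym (neg-involutive x))
    R≡2 : n ℕ.% 3 ≡ 2 → ∀ z → R n z → + 3 ∣ norm z + 1ℤ
    R≡2 e z r = subst (+ 3 ∣_) (f (norm z)) (∣m∣n⇒∣m+n (R-mod 2 z e r) ∣-refl)
      where
      f : ∀ m → m - + 2 + + 3 ≡ m + 1ℤ
      f = solve-∀
    cases : ∀ r → n ℕ.% 3 ≡ r → r ℕ.< 3 → Goal (χ n)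
    cases 0 e _ = contradiction (ℕ.m%n≡0⇒n∣m n 3 e) 3∤n
    cases 1 e _ = subst Goal (sym (cong χ-residue e))
      ( count-half {Q = 3∣y} {Q′ = 3∣x} {k} swap (λ _ → refl) R-swap (λ _ h → h) (λ _ h → h) (λ z → + 3 ∣? proj₂ z)
          (λ z r → Norm≡1.disjoint z (R-mod 1 z e r)) (λ z r → Norm≡1.cover z (R-mod 1 z e r)) C
      , count-∅ (λ z (r , h) → Norm≡1.¬3∣y-x z (R-mod 1 z e r) h))
    cases 2 e _ = subst Goal (sym (cong χ-residue e))
      ( count-∅ (λ z (r , h) → Norm≡2.¬3∣y z (R≡2 e z r) h)
      , count-half {Q = 3∣y-x} {Q′ = 3∣y+x} {k} neg (λ (x , y) → cong (_, y) (neg-involutive x)) R-neg to-+ to--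
          (λ z → + 3 ∣? (proj₂ z - proj₁ z))
          (λ z r → Norm≡2.disjoint z (R≡2 e z r)) (λ z r → Norm≡2.cover z (R≡2 e z r)) C)
    cases (suc (suc (suc _))) _ (s≤s (s≤s (s≤s ())))

  -- As 3 is inert, 3 ∣ x² + y² forces 3 ∣ x and 3 ∣ y, so both congruences hold throughout `R n`.
  count-3∣ : ∀ {n k} → 3 ℕ.∣ n → Count (R n) k →
    Count (λ z → R n z × 3∣y z) k × Count (λ z → R n z × 3∣y-x z) k
  count-3∣ {n} 3∣n C =
    count-cong (λ z r → r , 3∣₂ z r) (λ _ → proj₁) C ,
    count-cong (λ z r → r , ∣m∣n⇒∣m-n (3∣₂ z r) (3∣₁ z r)) (λ _ → proj₁) C
    where
    open NonResidue 3 prime[3] refl using (∣-sum-of-squares)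
    3∣norm : ∀ z → R n z → + 3 ∣ norm z
    3∣norm z r = subst (+ 3 ∣_) (sym r) (∣-pos⁺ 3∣n)
    3∣₁ : ∀ z → R n z → 3∣x z
    3∣₁ z@(x , y) r = ∣-sum-of-squares x y (3∣norm z r)
    3∣₂ : ∀ z → R n z → 3∣y z
    3∣₂ z@(x , y) r = ∣-sum-of-squares y x (subst (+ 3 ∣_) (+-comm (x * x) (y * y)) (3∣norm z r))

  -- Passage from sums of two squares to the two forms.

  rep-1-0-9 : ∀ {n m} → Count (λ z → R n z × 3∣y z) m → RepNumber (+ 1) (+ 0) (+ 9) n m
  rep-1-0-9 {n} = count-bij⁻ f inj (λ z r → trans (norm-f z) r , divides (proj₂ z) refl) back
    where
    f : ℤ × ℤ → ℤ × ℤ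
    f (x , y) = x , y * + 3
    inj : ∀ {z w} → f z ≡ f w → z ≡ w
    inj {_ , y} {_ , y′} e = cong₂ _,_ (cong proj₁ e) (*-cancelʳ-≡ y y′ (+ 3) (cong proj₂ e))
    norm-f : ∀ z → norm (f z) ≡ form (+ 1) (+ 0) (+ 9) z
    norm-f (x , y) = g x y
      where
      g : ∀ x y → x * x + y * + 3 * (y * + 3) ≡ + 1 * x * x + + 0 * x * y + + 9 * y * y
      g = solve-∀
    back : ∀ z → R n z × 3∣y z → ∃ λ w → form (+ 1) (+ 0) (+ 9) w ≡ + n × z ≡ f w
    back (x , y) (r , divides k e) = (x , k) , trans (sym (norm-f (x , k))) (trans (cong norm (sym eq)) r) , eq
      where
      eq : (x , y) ≡ f (x , k)
      eq = cong (x ,_) e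

  rep-2-2-5 : ∀ {n m} → Count (λ z → R n z × 3∣y-x z) m → RepNumber (+ 2) (+ 2) (+ 5) n m
  rep-2-2-5 {n} = count-bij⁻ f inj (λ z r → trans (norm-f z) r , divides (proj₂ z) (diff z)) back
    where
    f : ℤ × ℤ → ℤ × ℤ
    f (x , y) = x - y , x + + 2 * y
    diff : ∀ z → proj₂ (f z) - proj₁ (f z) ≡ proj₂ z * + 3
    diff (x , y) = g x y
      where
      g : ∀ x y → x + + 2 * y - (x - y) ≡ y * + 3
      g = solve-∀
    inj : ∀ {z w} → f z ≡ f w → z ≡ w
    inj {x , y} {x′ , y′} e = cong₂ _,_
      (trans (g x y) (trans (cong₂ _+_ (cong proj₁ e) y≡y′) (sym (g x′ y′)))) y≡y′
      where
      g : ∀ x y → x ≡ x - y + y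
      g = solve-∀
      y≡y′ : y ≡ y′
      y≡y′ = *-cancelʳ-≡ y y′ (+ 3) (trans (sym (diff (x , y))) (trans (cong (λ u → proj₂ u - proj₁ u) e) (diff (x′ , y′))))
    norm-f : ∀ z → norm (f z) ≡ form (+ 2) (+ 2) (+ 5) z
    norm-f (x , y) = g x y
      where
      g : ∀ x y → (x - y) * (x - y) + (x + + 2 * y) * (x + + 2 * y) ≡ + 2 * x * x + + 2 * x * y + + 5 * y * y
      g = solve-∀
    back : ∀ z → R n z × 3∣y-x z → ∃ λ w → form (+ 2) (+ 2) (+ 5) w ≡ + n × z ≡ f w
    -- Solving u = x - y and v - u = 3y with v - u = 3k gives y = k and x = u + k.
    back (u , v) (r , divides k e) = (u + k , k) , trans (sym (norm-f (u + k , k))) (trans (cong norm (sym eq)) r) , eq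
      where
      g₁ : ∀ u k → u ≡ u + k - k
      g₁ = solve-∀
      g₂ : ∀ u v → v ≡ u + (v - u)
      g₂ = solve-∀
      g₃ : ∀ u k → u + k * + 3 ≡ u + k + + 2 * k
      g₃ = solve-∀
      eq : (u , v) ≡ f (u + k , k)
      eq = cong₂ _,_ (g₁ u k) (trans (g₂ u v) (trans (cong (λ d → u + d) e) (g₃ u k)))

  evenness-odd : ∀ b → b ℕ.% 2 ≡ 1 → evenness b ≡ 0ℤ
  evenness-odd 1             _ = refl
  evenness-odd (suc (suc b)) e = evenness-odd b (trans (sym (trans (cong (ℕ._% 2) (ℕ.+-comm 2 b)) ([m+n]%n≡m%n b 2))) e)

  evenness-even : ∀ b → b ℕ.% 2 ≡ 0 → evenness b ≡ 1ℤ
  evenness-even 0             _ = refl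
  evenness-even (suc (suc b)) e = evenness-even b (trans (sym (trans (cong (ℕ._% 2) (ℕ.+-comm 2 b)) ([m+n]%n≡m%n b 2))) e)

  3∤-b≡0 : ∀ a ps qs → All ValidP ps → All ValidQ qs → ¬ 3 ℕ.∣ 2 ℕ.^ a ℕ.* factors ps ℕ.* factors qs
  3∤-b≡0 a ps qs vp vq h =
    [ (λ h → [ (λ h → from-no (3 ℕ.∣? 2) (prime∣^ prime[3] 2 a h)) , ¬inert-∣-ps ps vp 3 prime[3] refl ]′
        (euclidsLemma (2 ℕ.^ a) (factors ps) prime[3] h))
    , 3∤qs qs vq ]′ (euclidsLemma (2 ℕ.^ a ℕ.* factors ps) (factors qs) prime[3] h)

  reps-b≡0 : ∀ a ps qs → All ValidP ps → Unique (map proj₁ ps) → All ValidQ qs → Unique (map proj₁ qs) →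
    let n = 2 ℕ.^ a ℕ.* factors ps ℕ.* factors qs in
    RepNumber (+ 1) (+ 0) (+ 9) n ((1ℤ + sgn (a ℕ.+ tCount ps)) * Λ ps qs)
    × RepNumber (+ 2) (+ 2) (+ 5) n ((1ℤ - sgn (a ℕ.+ tCount ps)) * Λ ps qs)
  reps-b≡0 a ps qs vp up vq uq =
    rep-1-0-9 (subst (Count (λ z → R n z × 3∣y z)) plus (proj₁ halves)) ,
    rep-2-2-5 (subst (Count (λ z → R n z × 3∣y-x z)) minus (proj₂ halves))
    where
    n = 2 ℕ.^ a ℕ.* factors ps ℕ.* factors qs
    s = sgn (a ℕ.+ tCount ps)
    C : Count (R n) (+ 4 * Λ ps qs)
    C = subst₂ (λ m → Count (R m)) (cong (λ m → m ℕ.* factors ps ℕ.* factors qs) (ℕ.*-identityʳ (2 ℕ.^ a)))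
      (*-identityˡ (+ 4 * Λ ps qs)) (count-total a 0 ps qs vp up vq uq)
    halves = count-3∤ {n} {Λ ps qs} (3∤-b≡0 a ps qs vp vq) C
    f⁺ : ∀ s l → (1ℤ + s) * l ≡ l + s * l
    f⁺ = solve-∀
    f⁻ : ∀ s l → (1ℤ - s) * l ≡ l - s * l
    f⁻ = solve-∀
    -- χ n and s are known to agree only after multiplication by Λ, so the products are expanded
    -- first.
    plus : (1ℤ + χ n) * Λ ps qs ≡ (1ℤ + s) * Λ ps qs
    plus = trans (f⁺ (χ n) (Λ ps qs)) (trans (cong (λ u → Λ ps qs + u) (χ-Λ a ps qs vp vq)) (sym (f⁺ s (Λ ps qs))))
    minus : (1ℤ - χ n) * Λ ps qs ≡ (1ℤ - s) * Λ ps qs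
    minus = trans (f⁻ (χ n) (Λ ps qs)) (trans (cong (λ u → Λ ps qs - u) (χ-Λ a ps qs vp vq)) (sym (f⁻ s (Λ ps qs))))

  -- Treats both parities of b > 0 together: the factor `evenness b` becomes 0 or 1 afterwards.
  reps-b≢0 : ∀ a b ps qs → b ≢ 0 → All ValidP ps → Unique (map proj₁ ps) → All ValidQ qs → Unique (map proj₁ qs) →
    let n = 2 ℕ.^ a ℕ.* 3 ℕ.^ b ℕ.* factors ps ℕ.* factors qs in
    RepNumber (+ 1) (+ 0) (+ 9) n (evenness b * (+ 4 * Λ ps qs))
    × RepNumber (+ 2) (+ 2) (+ 5) n (evenness b * (+ 4 * Λ ps qs))
  reps-b≢0 a zero    ps qs b≢0 = contradiction refl b≢0
  reps-b≢0 a (suc b) ps qs _ vp up vq uq = rep-1-0-9 (proj₁ both) , rep-2-2-5 (proj₂ both)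
    where
    3∣n : 3 ℕ.∣ 2 ℕ.^ a ℕ.* 3 ℕ.^ suc b ℕ.* factors ps ℕ.* factors qs
    3∣n = ℕ.∣m⇒∣m*n (factors qs) (ℕ.∣m⇒∣m*n (factors ps) (ℕ.∣n⇒∣m*n (2 ℕ.^ a) (ℕ.m∣m*n (3 ℕ.^ b))))
    both = count-3∣ 3∣n (count-total a (suc b) ps qs vp up vq uq)

-- The representation numbers of both forms, by the exponent of 3.

open import Data.Nat as ℕ using (ℕ; _^_; _*_; _+_; _%_)
open import Data.Integer as ℤ using (ℤ; +_)
open import Data.Product using (_×_; proj₁)
open import Data.List using (List; map)
open import Data.List.Relation.Unary.All using (All)
open import Data.List.Relation.Unary.Unique.Propositional using (Unique)
open import Relation.Binary.PropositionalEquality using (_≡_; _≢_)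

open import Data.Nat.Properties using (*-identityʳ)
import Data.Integer.Properties as ℤ
open GaussianNorm using (evenness)
open TwoSquareCount using (factors)
open QuadraticForms using (evenness-odd; evenness-even; reps-b≡0; reps-b≢0)

theorem4p1 : (n a b : ℕ) (ps qs : List (ℕ × ℕ)) →
    All ValidP ps → Unique (map proj₁ ps) →
    All ValidQ qs → Unique (map proj₁ qs) →
    n ≡ 2 ^ a * 3 ^ b * prodℕ (map primePow ps) * prodℕ (map primePow qs) →
    ((b ≡ 0 →
    RepNumber (+ 1) (+ 0) (+ 9) n ((ℤ.1ℤ ℤ.+ sgn (a + tCount ps)) ℤ.* Λ ps qs)
    × RepNumber (+ 2) (+ 2) (+ 5) n ((ℤ.1ℤ ℤ.- sgn (a + tCount ps)) ℤ.* Λ ps qs))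
    × (b % 2 ≡ 1 →
    RepNumber (+ 1) (+ 0) (+ 9) n (+ 0)
    × RepNumber (+ 2) (+ 2) (+ 5) n (+ 0))
    × (b ≢ 0 → b % 2 ≡ 0 →
    RepNumber (+ 1) (+ 0) (+ 9) n (+ 4 ℤ.* Λ ps qs)
    × RepNumber (+ 2) (+ 2) (+ 5) n (+ 4 ℤ.* Λ ps qs)))
theorem4p1 n a b ps qs vp up vq uq refl = b≡0 , b-odd , b-even
  where
  BothReps : ℕ → ℤ → ℤ → Set
  BothReps n k l = RepNumber (+ 1) (+ 0) (+ 9) n k × RepNumber (+ 2) (+ 2) (+ 5) n l

  s : ℤ
  s = sgn (a + tCount ps)

  b≡0 : b ≡ 0 → BothReps n ((ℤ.1ℤ ℤ.+ s) ℤ.* Λ ps qs) ((ℤ.1ℤ ℤ.- s) ℤ.* Λ ps qs)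
  b≡0 refl = subst (λ m → BothReps (m * factors ps * factors qs)
      ((ℤ.1ℤ ℤ.+ s) ℤ.* Λ ps qs) ((ℤ.1ℤ ℤ.- s) ℤ.* Λ ps qs)) (sym (*-identityʳ (2 ^ a)))
    (reps-b≡0 a ps qs vp up vq uq)

  b≢0 : ∀ {ε} → b ≢ 0 → evenness b ≡ ε → BothReps n (ε ℤ.* (+ 4 ℤ.* Λ ps qs)) (ε ℤ.* (+ 4 ℤ.* Λ ps qs))
  b≢0 ne refl = reps-b≢0 a b ps qs ne vp up vq uq

  b-odd : b % 2 ≡ 1 → BothReps n (+ 0) (+ 0)
  -- With ε = 0 the size computes to `+ 0`.
  b-odd odd = b≢0 (λ { refl → case odd of λ () }) (evenness-odd b odd)

  b-even : b ≢ 0 → b % 2 ≡ 0 → BothReps n (+ 4 ℤ.* Λ ps qs) (+ 4 ℤ.* Λ ps qs)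
  b-even ne even = subst (λ k → BothReps n k k) (ℤ.*-identityˡ (+ 4 ℤ.* Λ ps qs)) (b≢0 ne (evenness-even b even))
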